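{- Let $n\equiv 0\pmod 4$, let $p\geq 0$ be an integer with $n\geq 4p+3$, and let $\epsilon$ be a positive integer with $\epsilon\leq (n-4p)/2$ and $\gcd(\epsilon,n)=1$. If there exists an integer $\alpha$ with $\gcd(\alpha,n)=1$ and $2p+\epsilon \leq \alpha\leq n-\epsilon-2p$, then there exists a globally simple Heffter array $H(n;4p+3)$.
   Context: A Heffter array $H(n;k)$ is an $n\times n$ array of integers (some cells may be empty) such that: each row and each column contains exactly $k$ filled cells; the entries in every row and every column sum to $0$ modulo $2nk+1$; and for each integer $1\leq x\leq nk$, either $x$ or $-x$ appears in the array. Rows and columns are indexed by $0,1,\dots,n-1$. The natural ordering of a row lists its filled cells from left to right (increasing column index), and that of a column from top to bottom (increasing row index). The array is globally simple if, for every row and every column, writing its entries in natural order as $a_0,\dots,a_{k-1}$, the partial sums $\sum_{j=0}^{i}a_j$, $i=0,\dots,k-1$, are pairwise distinct modulo $2nk+1$. -}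

module Defs where

open import Data.Nat as ℕ using (ℕ; suc)
open import Data.Integer as ℤ using (ℤ; +_; -_; _-_)
open import Data.Integer.Divisibility using (_∣_)
open import Data.Fin using (Fin; _<_)
open import Data.List using (List; []; _∷_; length; take; allFin; mapMaybe; foldr)
open import Data.Maybe using (Maybe; just; nothing)
open import Data.Product using (Σ; ∃; ∃-syntax; _×_; _,_)
open import Data.Sum using (_⊎_)
open import Relation.Binary.PropositionalEquality using (_≡_)
open import Relation.Nullary using (¬_)

-- A partially filled n×n array of integers: nothing = empty cell.
PArray : ℕ → Set
PArray n = Fin n → Fin n → Maybe ℤ

_≡[mod_]_ : ℤ → ℕ → ℤ → Set
x ≡[mod m ] y = (+ m) ∣ (x - y)

rowEntries : ∀ {n} → PArray n → Fin n → List ℤ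
rowEntries {n} A i = mapMaybe (λ j → A i j) (allFin n)

colEntries : ∀ {n} → PArray n → Fin n → List ℤ
colEntries {n} A j = mapMaybe (λ i → A i j) (allFin n)

sumℤ : List ℤ → ℤ
sumℤ = foldr ℤ._+_ (+ 0)

hmod : ℕ → ℕ → ℕ
hmod n k = 2 ℕ.* n ℕ.* k ℕ.+ 1

partialSum : (l : List ℤ) → Fin (length l) → ℤ
partialSum l i = sumℤ (take (suc (Data.Fin.toℕ i)) l)
  where import Data.Fin

SimpleMod : ℕ → List ℤ → Set
SimpleMod m l = ∀ (i j : Fin (length l)) → i < j →
  ¬ (partialSum l i ≡[mod m ] partialSum l j)

record IsHeffter (n k : ℕ) (A : PArray n) : Set where
  field
    rowCount : ∀ i → length (rowEntries A i) ≡ k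
    colCount : ∀ j → length (colEntries A j) ≡ k
    rowSum   : ∀ i → sumℤ (rowEntries A i) ≡[mod hmod n k ] (+ 0)
    colSum   : ∀ j → sumℤ (colEntries A j) ≡[mod hmod n k ] (+ 0)
    covers   : ∀ (x : ℕ) → 1 ℕ.≤ x → x ℕ.≤ n ℕ.* k →
               ∃[ i ] ∃[ j ] (A i j ≡ just (+ x) ⊎ A i j ≡ just (- (+ x)))

IsGloballySimple : (n k : ℕ) → PArray n → Set
IsGloballySimple n k A =
  (∀ i → SimpleMod (hmod n k) (rowEntries A i)) ×
  (∀ j → SimpleMod (hmod n k) (colEntries A j))

{-# OPTIONS --safe #-}
-- Write n = 4m, so that p < m, and organise the cells (i, j) by their
-- offset d = j - i mod n.  The offsets 0, 2m - 1, 2m + 1 carry an integer Heffter array H(n; 3),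
-- tridiagonal after multiplying indices by the involution 2m + 1 of ℤ/n.  The p pairs of adjacent offsets
-- after 0 and the p pairs after 2m + 1 carry the remaining values; in a row (column) every pair of the
-- first group adds to - K and every pair of the second to K, with K = 8m in rows and
-- K = 8m + 1 (4m + 1 in column 0) in columns.
-- All partial sums of a line, started at offset 0, then lie in an interval of 2nk + 1 integers: the sums
-- inside pairs of the first group lie above, those inside pairs of the second group below all others, and
-- the latter are distinct because the entries a, b, c of H(n; 3) in the line avoid the relevant
-- multiples of K.  As the line sums to 0, starting elsewhere or reversing the order changes nothing.
module Submission where

open import Defs

-- Let `B j`, `C j` be the entries of column `j` at offsets 2m + 1 and 2m - 1; its diagonal entry
-- must be - (B j + C j). The row sums vanish by one relation, C (i + 2m - 1) = B i + 3m with
-- indices mod n: row i then holds C i - 3m and B i + 3m beside the diagonal entry of column i. The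
-- nets come from the values. Index q of a pair owns the 16m values 12m + 16mq + 1, ..., 12m + 16m(q
-- + 1), in quarters of 4m, one for each of the four offsets concerned. In a row a size X is paired
-- with X + 8m, two quarters later and one column to the right. As X drops by 1 per column, a column
-- nets 8m + 1; from column n - 1 to column 0 it rises by 4m - 1 instead, whence 8m - (4m - 1) = 4m
-- + 1 there. The nets of the two groups have opposite signs so that their drifts, - K p and K p,
-- cancel. Each inner entry is linear in m and in a position u within one of five classes of
-- columns, so every inequality is checked once per class, by evaluation on coefficients.

module Heffter where

  open import Data.Bool using (T)
  open import Data.Empty using (⊥; ⊥-elim)
  open import Data.Fin as Fin using (Fin; zero; suc; toℕ; fromℕ<)
  import Data.Fin.Properties as Fin
  open import Data.Integer using (ℤ; +_; -[1+_]; -_; _+_; _-_; _*_; _≤_; _≤ᵇ_; +≤+)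
  open import Data.Integer.Divisibility using (_∣_)
  import Data.Integer.Properties as ℤ
  open import Data.Integer.Tactic.RingSolver using (solve)
  open import Data.List using (List; []; _∷_; length; mapMaybe; tabulate)
  open import Data.Maybe using (Maybe; just; nothing)
  open import Data.Nat as ℕ using (ℕ; zero; suc; z≤n; s≤s)
  import Data.Nat.Divisibility as ℕ
  import Data.Nat.DivMod as ℕ
  import Data.Nat.Properties as ℕ
  import Data.Nat.Tactic.RingSolver as ℕ-Solver
  open import Data.Product using (_×_; _,_; ∃-syntax)
  open import Data.Sum using (_⊎_; inj₁; inj₂)
  open import Data.Unit using (⊤; tt)
  open import Function using (_∘_)
  open import Relation.Binary.Definitions using (tri<; tri≈; tri>)
  open import Relation.Binary.PropositionalEquality using (_≡_; _≢_; refl; sym; trans; cong; cong₂; subst)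
  open import Relation.Nullary using (¬_; contradiction; yes; no)

  -- Certificates for integer inequalities

  0≤_ : ℤ → Set
  0≤ x = + 0 ≤ x

  infix 4 0≤_
  infixl 6 _⊕_
  infixl 7 _⊗_

  _⊕_ : ∀ {x y} → 0≤ x → 0≤ y → 0≤ x + y
  _⊕_ = ℤ.+-mono-≤

  _⊗_ : ∀ {x y} → 0≤ x → 0≤ y → 0≤ x * y
  _⊗_ {+ a} {+ b} _ _ = subst 0≤_ (ℤ.pos-* a b) (+≤+ z≤n)

  nat : ∀ k → 0≤ + k
  nat k = +≤+ z≤n

  infixl 5 _▸_
  -- Inequalities are proved by certificates: a sum of products of nonnegative terms, built with
  -- `_⊕_` and `_⊗_`, and a ring identity that equates it with the goal. A contradiction is a
  -- certificate whose value is a negative constant.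
  _▸_ : ∀ {x y} → 0≤ x → x ≡ y → + 0 ≤ y
  h ▸ refl = h

  absurd : ∀ k → 0≤ -[1+ k ] → ⊥
  absurd _ ()

  difference₁ : ∀ {x y} → x ≡ y → 0≤ x - y
  difference₁ {x} refl = ℤ.≤-reflexive (sym (ℤ.+-inverseʳ x))

  difference₂ : ∀ {x y} → x ≡ y → 0≤ y - x
  difference₂ {x} refl = ℤ.≤-reflexive (sym (ℤ.+-inverseʳ x))

  cast-≤ : ∀ {a b} → a ℕ.≤ b → 0≤ + b - + a
  cast-≤ a≤b = ℤ.i≤j⇒0≤j-i (+≤+ a≤b)

  cast-< : ∀ {a b} → a ℕ.< b → 0≤ + b - (+ 1 + + a)
  cast-< = cast-≤

  -- The first quarter, of 4 M values, of the 16 M values that belong to index `Q`.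
  record InBlock (M Q X : ℤ) : Set where
    field
      above : 0≤ X - (+ 16 * M * Q + + 12 * M + + 1)
      below : 0≤ + 16 * M * (Q + + 1) - X

  -- The partial sums of a line with entries a, c, b at the offsets 0, 2m - 1, 2m + 1 are a - K Q + X and
  -- - K (P - Q) - (X + 4 M) inside pair Q of the first and second group, and a - K Q, - K (P - Q), a + c - K P
  -- elsewhere.
  module LineArithmetic (M P K a b c : ℤ)
    (1≤M : 0≤ M - + 1) (0≤P : 0≤ P)
    (K-low : 0≤ K - + 4 * M - + 1) (K-high : 0≤ + 8 * M + + 1 - K)
    (a+b+c : a + b + c ≡ + 0)
    (a-low : 0≤ + 5 * M + a) (a-high : 0≤ + 5 * M - a)
    (b-low : 0≤ + 11 * M + b) (b-high : 0≤ + 12 * M - b) (c-high : 0≤ + 12 * M - c)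
    where

    open InBlock

    0≤K : 0≤ K
    0≤K = (K-low ⊕ nat 4 ⊗ 1≤M ⊕ nat 5) ▸ solve (M ∷ K ∷ [])

    slope : 0≤ + 16 * M - K
    slope = (K-high ⊕ nat 8 ⊗ 1≤M ⊕ nat 7) ▸ solve (M ∷ K ∷ [])

    private
      -- `X` gains 16 M per block, up to an error below 4 M, while `K` takes off at most 8 M + 1 per
      -- pair; so the sums inside pairs move strictly with `Q`, in both groups.
      block-step : ∀ Q Q' X X' → 0≤ Q' - (+ 1 + Q) → InBlock M Q X → InBlock M Q' X' →
                   0≤ X' - X - K * (Q' - Q) - + 4
      block-step Q Q' X X' Q<Q' x x' =
        (x' .above ⊕ x .below ⊕ slope ⊗ Q<Q' ⊕ K-high ⊕ nat 4 ⊗ 1≤M)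
          ▸ solve (M ∷ K ∷ Q ∷ Q' ∷ X ∷ X' ∷ [])

    high≢high : ∀ Q Q' X X' → 0≤ Q' - (+ 1 + Q) → InBlock M Q X → InBlock M Q' X' →
                (a - K * Q + X) ≢ (a - K * Q' + X')
    high≢high Q Q' X X' Q<Q' x x' e =
      absurd 3 ((block-step Q Q' X X' Q<Q' x x' ⊕ difference₁ e) ▸ solve (M ∷ K ∷ a ∷ Q ∷ Q' ∷ X ∷ X' ∷ []))

    low≢low : ∀ Q Q' X X' → 0≤ Q' - (+ 1 + Q) → InBlock M Q X → InBlock M Q' X' →
              (- (K * (P - Q)) - (X + + 4 * M)) ≢ (- (K * (P - Q')) - (X' + + 4 * M))
    low≢low Q Q' X X' Q<Q' x x' e =
      absurd 3 ((block-step Q Q' X X' Q<Q' x x' ⊕ difference₂ e) ▸ solve (M ∷ P ∷ K ∷ Q ∷ Q' ∷ X ∷ X' ∷ []))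

    private
      net-step : ∀ Q Q' → 0≤ Q' - (+ 1 + Q) → 0≤ K * (Q' - Q) - + 1
      net-step Q Q' Q<Q' = (0≤K ⊗ Q<Q' ⊕ K-low ⊕ nat 4 ⊗ 1≤M ⊕ nat 4) ▸ solve (M ∷ K ∷ Q ∷ Q' ∷ [])

    up≢up : ∀ Q Q' → 0≤ Q' - (+ 1 + Q) → (a - K * Q) ≢ (a - K * Q')
    up≢up Q Q' Q<Q' e = absurd 0 ((net-step Q Q' Q<Q' ⊕ difference₂ e) ▸ solve (K ∷ a ∷ Q ∷ Q' ∷ []))

    down≢down : ∀ Q Q' → 0≤ Q' - (+ 1 + Q) → (- (K * (P - Q))) ≢ (- (K * (P - Q')))
    down≢down Q Q' Q<Q' e = absurd 0 ((net-step Q Q' Q<Q' ⊕ difference₁ e) ▸ solve (P ∷ K ∷ Q ∷ Q' ∷ []))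

    private
      not-multiple : a ≢ + 0 → 0≤ K - a - + 1 → 0≤ K + a - + 1 → ∀ t → a ≢ K * t
      not-multiple a≢0 a<K -K<a (+ 0) e = a≢0 (trans e (ℤ.*-zeroʳ K))
      not-multiple a≢0 a<K -K<a (+ suc t) e = positive (+ t) (nat t) e
        where
        positive : ∀ T → 0≤ T → a ≢ K * (+ 1 + T)
        positive T 0≤T e = absurd 0 ((a<K ⊕ 0≤K ⊗ 0≤T ⊕ difference₁ e) ▸ solve (K ∷ a ∷ T ∷ []))
      not-multiple a≢0 a<K -K<a -[1+ t ] e = negative (+ t) (nat t) e
        where
        negative : ∀ T → 0≤ T → a ≢ K * - (+ 1 + T)
        negative T 0≤T e = absurd 0 ((-K<a ⊕ 0≤K ⊗ 0≤T ⊕ difference₂ e) ▸ solve (K ∷ a ∷ T ∷ []))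

    -- Equality would make `a` the multiple Q + Q' - P of `K`, a factor of either sign, which 0 <
    -- |a| < K excludes.
    up≢down : a ≢ + 0 → 0≤ K - a - + 1 → 0≤ K + a - + 1 → ∀ Q Q' → (a - K * Q) ≢ (- (K * (P - Q')))
    up≢down a≢0 a<K -K<a Q Q' e = not-multiple a≢0 a<K -K<a (Q + Q' - P) (ring Q Q' e)
      where
      ring : ∀ Q Q' → (a - K * Q) ≡ (- (K * (P - Q'))) → a ≡ K * (Q + Q' - P)
      ring Q Q' e = trans {j = (a - K * Q) + K * Q} (solve (K ∷ a ∷ Q ∷ []))
                      (trans (cong (_+ K * Q) e) (solve (P ∷ K ∷ Q ∷ Q' ∷ [])))

    up≡middle : ∀ Q → (a - K * Q) ≡ (a + c - K * P) → c ≡ K * (P - Q)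
    up≡middle Q e = trans {j = (a + c - K * P) - (a - K * Q) + K * (P - Q)} (solve (P ∷ K ∷ a ∷ c ∷ Q ∷ []))
      (trans (cong (λ z → (a + c - K * P) - z + K * (P - Q)) e) (solve (P ∷ K ∷ a ∷ c ∷ Q ∷ [])))

    -- As a + b + c = 0, the sum a + c - K P equals - b - K P, so this clash becomes a condition on
    -- `b`.
    down≡middle : ∀ Q → (- (K * (P - Q))) ≡ (a + c - K * P) → b ≡ - (K * Q)
    down≡middle Q e = trans {j = (a + b + c) - (a + c)} (solve (a ∷ b ∷ c ∷ []))
      (trans {j = (- (K * (P - Q))) - (a + c - K * P) - K * Q}
        (trans (cong (_- (a + c)) a+b+c) (solve (P ∷ K ∷ a ∷ c ∷ Q ∷ [])))
        (trans (cong (λ z → z - (a + c - K * P) - K * Q) e) (solve (P ∷ K ∷ a ∷ c ∷ Q ∷ []))))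

    -- The sums inside pairs lie beyond `lower` and `upper`. The bound `top` serves the window,
    -- whose ceiling a + 12 M may exceed when P = 0.
    record InMiddle (x : ℤ) : Set where
      field
        lower : 0≤ x + K * P + + 12 * M
        upper : 0≤ a + + 12 * M - x
        top   : 0≤ + 11 * M - x
    open InMiddle

    up-middle : ∀ Q → 0≤ Q → 0≤ P - Q → InMiddle ((a - K * Q))
    up-middle Q 0≤Q Q≤P = record
      { lower = (a-low ⊕ 0≤K ⊗ Q≤P ⊕ nat 7 ⊗ 1≤M ⊕ nat 7) ▸ solve (M ∷ P ∷ K ∷ a ∷ Q ∷ [])
      ; upper = (0≤K ⊗ 0≤Q ⊕ nat 12 ⊗ 1≤M ⊕ nat 12) ▸ solve (M ∷ K ∷ a ∷ Q ∷ [])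
      ; top   = (a-high ⊕ 0≤K ⊗ 0≤Q ⊕ nat 6 ⊗ 1≤M ⊕ nat 6) ▸ solve (M ∷ K ∷ a ∷ Q ∷ [])
      }

    down-middle : ∀ Q → 0≤ Q → 0≤ P - Q → InMiddle ((- (K * (P - Q))))
    down-middle Q 0≤Q Q≤P = record
      { lower = (0≤K ⊗ 0≤Q ⊕ nat 12 ⊗ 1≤M ⊕ nat 12) ▸ solve (M ∷ P ∷ K ∷ Q ∷ [])
      ; upper = (a-low ⊕ 0≤K ⊗ Q≤P ⊕ nat 7 ⊗ 1≤M ⊕ nat 7) ▸ solve (M ∷ P ∷ K ∷ a ∷ Q ∷ [])
      ; top   = (0≤K ⊗ Q≤P ⊕ nat 11 ⊗ 1≤M ⊕ nat 11) ▸ solve (M ∷ P ∷ K ∷ Q ∷ [])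
      }

    middle-middle : InMiddle (a + c - K * P)
    middle-middle = record
      { lower = (b-high ⊕ difference₁ a+b+c) ▸ solve (M ∷ P ∷ K ∷ a ∷ b ∷ c ∷ [])
      ; upper = (c-high ⊕ 0≤K ⊗ 0≤P) ▸ solve (M ∷ P ∷ K ∷ a ∷ c ∷ [])
      ; top   = (b-low ⊕ 0≤K ⊗ 0≤P ⊕ difference₂ a+b+c) ▸ solve (M ∷ P ∷ K ∷ a ∷ b ∷ c ∷ [])
      }

    high≢mid : ∀ Q X z → 0≤ Q → InBlock M Q X → InMiddle z → (a - K * Q + X) ≢ z
    high≢mid Q X z 0≤Q x mid e =
      absurd 0 ((x .above ⊕ slope ⊗ 0≤Q ⊕ mid .upper ⊕ difference₂ e) ▸ solve (M ∷ K ∷ a ∷ Q ∷ X ∷ z ∷ []))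

    low≢mid : ∀ Q X z → 0≤ Q → InBlock M Q X → InMiddle z → (- (K * (P - Q)) - (X + + 4 * M)) ≢ z
    low≢mid Q X z 0≤Q x mid e =
      absurd 0 ((x .above ⊕ slope ⊗ 0≤Q ⊕ mid .lower ⊕ nat 4 ⊗ 1≤M ⊕ nat 4 ⊕ difference₁ e)
        ▸ solve (M ∷ P ∷ K ∷ Q ∷ X ∷ z ∷ []))

    high≢low : ∀ Q Q' X X' → 0≤ Q → 0≤ Q' → InBlock M Q X → InBlock M Q' X' → (a - K * Q + X) ≢ (- (K * (P - Q')) - (X' + + 4 * M))
    high≢low Q Q' X X' 0≤Q 0≤Q' x x' e =
      -- The bounds on `middle-middle` give - K P - 12 M ≤ a + 12 M, and one of the two sums lies
      -- above the right side, the other below the left.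
      absurd 1 ((x .above ⊕ slope ⊗ 0≤Q ⊕ middle-middle .upper ⊕
               x' .above ⊕ slope ⊗ 0≤Q' ⊕ middle-middle .lower ⊕ nat 4 ⊗ 1≤M ⊕ nat 4 ⊕ difference₂ e)
        ▸ solve (M ∷ P ∷ K ∷ a ∷ c ∷ Q ∷ Q' ∷ X ∷ X' ∷ []))

    -- A window of exactly 2nk + 1 consecutive integers.
    record InWindow (x : ℤ) : Set where
      field
        floor : 0≤ x + (+ 16 * M * P + + 13 * M)
        ceil  : 0≤ + 16 * M * P + + 11 * M - x

    mid-window : ∀ z → InMiddle z → InWindow z
    mid-window z mid = record
      { floor = (mid .lower ⊕ slope ⊗ 0≤P ⊕ 1≤M ⊕ nat 1) ▸ solve (M ∷ P ∷ K ∷ z ∷ [])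
      ; ceil  = (mid .top ⊕ nat 16 ⊗ 1≤M ⊗ 0≤P ⊕ nat 16 ⊗ 0≤P) ▸ solve (M ∷ P ∷ z ∷ [])
      }

    high-window : ∀ Q X → 0≤ Q → 0≤ P - (+ 1 + Q) → InBlock M Q X → InWindow ((a - K * Q + X))
    high-window Q X 0≤Q Q<P x = record
      { floor = (x .above ⊕ slope ⊗ 0≤Q ⊕ nat 16 ⊗ 1≤M ⊗ 0≤P ⊕ nat 16 ⊗ 0≤P ⊕ a-low
                  ⊕ nat 20 ⊗ 1≤M ⊕ nat 21) ▸ solve (M ∷ P ∷ K ∷ a ∷ Q ∷ X ∷ [])
      ; ceil  = (x .below ⊕ slope ⊗ Q<P ⊕ 0≤K ⊗ (Q<P ⊕ 0≤Q) ⊕ a-high ⊕ nat 6 ⊗ 1≤M ⊕ nat 6)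
                  ▸ solve (M ∷ P ∷ K ∷ a ∷ Q ∷ X ∷ [])
      }

    -- The worst case is Q = P - 1, bounded below by - 16 M P - 12 M - 1; the floor admits it
    -- because M ≥ 1.
    low-window : ∀ Q X → 0≤ Q → 0≤ P - (+ 1 + Q) → InBlock M Q X → InWindow ((- (K * (P - Q)) - (X + + 4 * M)))
    low-window Q X 0≤Q Q<P x = record
      { floor = (x .below ⊕ slope ⊗ Q<P ⊕ K-high ⊕ 1≤M) ▸ solve (M ∷ P ∷ K ∷ Q ∷ X ∷ [])
      ; ceil  = (x .above ⊕ slope ⊗ 0≤Q ⊕ 0≤K ⊗ 0≤P ⊕ nat 16 ⊗ 1≤M ⊗ 0≤P ⊕ nat 16 ⊗ 0≤P
                  ⊕ nat 27 ⊗ 1≤M ⊕ nat 28) ▸ solve (M ∷ P ∷ K ∷ Q ∷ X ∷ [])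
      }

  -- Lists of filled cells and potentials along them

  prepend : Maybe ℤ → List ℤ → List ℤ
  prepend nothing  l = l
  prepend (just v) l = v ∷ l

  entries : (ℕ → Maybe ℤ) → ℕ → List ℤ
  entries f zero    = []
  entries f (suc n) = prepend (f 0) (entries (f ∘ suc) n)

  value count : Maybe ℤ → ℤ
  value nothing  = + 0
  value (just v) = v
  count nothing  = + 0
  count (just _) = + 1

  Filled : Maybe ℤ → Set
  Filled x = x ≢ nothing

  private
    mapMaybe-∷ : ∀ {A : Set} (g : A → Maybe ℤ) x xs → mapMaybe g (x ∷ xs) ≡ prepend (g x) (mapMaybe g xs)
    mapMaybe-∷ g x xs with g x
    ... | nothing = refl
    ... | just _  = refl

    mapMaybe-tabulate : ∀ {A : Set} n (f : ℕ → Maybe ℤ) (g : A → Maybe ℤ) (h : Fin n → A) →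
                        (∀ k → g (h k) ≡ f (toℕ k)) → mapMaybe g (tabulate h) ≡ entries f n
    mapMaybe-tabulate zero    f g h e = refl
    mapMaybe-tabulate (suc n) f g h e
      rewrite mapMaybe-∷ g (h zero) (tabulate (h ∘ suc)) | e zero
            | mapMaybe-tabulate n (f ∘ suc) g (h ∘ suc) (e ∘ suc) = refl

  rowEntries-entries : ∀ {n} (A : PArray n) i f → (∀ j → A i j ≡ f (toℕ j)) → rowEntries A i ≡ entries f n
  rowEntries-entries {n} A i f = mapMaybe-tabulate n f (A i) (λ j → j)

  colEntries-entries : ∀ {n} (A : PArray n) j f → (∀ i → A i j ≡ f (toℕ i)) → colEntries A j ≡ entries f n
  colEntries-entries {n} A j f = mapMaybe-tabulate n f (λ i → A i j) (λ i → i)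

  -- Partial sums become differences of `Φ`, with weight `value` for sums and `count` for lengths.
  -- The starting value of `Φ` is free, so one cyclic sequence of levels serves a line wherever its
  -- first cell falls.
  Potential : (Maybe ℤ → ℤ) → (ℕ → Maybe ℤ) → ℕ → (ℕ → ℤ) → Set
  Potential w f n Φ = ∀ t → t ℕ.< n → Φ (suc t) ≡ Φ t + w (f t)

  private
    telescope : ∀ x y z v → y ≡ x + v → v + (z - y) ≡ z - x
    telescope x _ z v refl = solve (x ∷ z ∷ v ∷ [])

  sum-entries : ∀ n f Φ → Potential value f n Φ → sumℤ (entries f n) ≡ Φ n - Φ 0
  sum-entries zero    f Φ step = sym (ℤ.+-inverseʳ (Φ 0))
  sum-entries (suc n) f Φ step
    with f 0 | step 0 (s≤s z≤n) | sum-entries n (f ∘ suc) (Φ ∘ suc) (λ t t<n → step (suc t) (s≤s t<n))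
  ... | nothing | e | ih = trans ih (cong (λ z → Φ (suc n) - z) (trans e (ℤ.+-identityʳ (Φ 0))))
  ... | just v  | e | ih = trans (cong (λ z → v + z) ih) (telescope (Φ 0) (Φ 1) (Φ (suc n)) v e)

  length-entries : ∀ n f Φ → Potential count f n Φ → + length (entries f n) ≡ Φ n - Φ 0
  length-entries zero    f Φ step = sym (ℤ.+-inverseʳ (Φ 0))
  length-entries (suc n) f Φ step
    with f 0 | step 0 (s≤s z≤n) | length-entries n (f ∘ suc) (Φ ∘ suc) (λ t t<n → step (suc t) (s≤s t<n))
  ... | nothing | e | ih = trans ih (cong (λ z → Φ (suc n) - z) (trans e (ℤ.+-identityʳ (Φ 0))))
  ... | just v  | e | ih = trans (cong (λ z → + 1 + z) ih) (telescope (Φ 0) (Φ 1) (Φ (suc n)) (+ 1) e)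

  -- The index `i` counts filled cells only. The position `t` it comes from stays existential; that
  -- it is filled is what allows `Distinct` to be applied there.
  partialSum-entries : ∀ n f Φ → Potential value f n Φ → (i : Fin (length (entries f n))) →
    ∃[ t ] (t ℕ.< n × Filled (f t) × Φ 0 + partialSum (entries f n) i ≡ Φ (suc t))
  partialSum-entries (suc n) f Φ step
    with f 0 in f0 | step 0 (s≤s z≤n) | partialSum-entries n (f ∘ suc) (Φ ∘ suc) (λ t t<n → step (suc t) (s≤s t<n))
  ... | nothing | e | ih = λ i → let t , t<n , filled , eq = ih i in
    suc t , s≤s t<n , filled ,
    trans (cong (_+ partialSum (entries (f ∘ suc) n) i) (trans (sym (ℤ.+-identityʳ (Φ 0))) (sym e))) eq
  ... | just v | e | ih = λ
    { zero → 0 , s≤s z≤n , (λ z → contradiction (trans (sym f0) z) λ ()) ,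
             trans (cong (λ z → Φ 0 + z) (ℤ.+-identityʳ v)) (sym e)
    ; (suc i) → let t , t<n , filled , eq = ih i in
             suc t , s≤s t<n , filled ,
             trans (trans (sym (ℤ.+-assoc (Φ 0) v _)) (cong (_+ partialSum (entries (f ∘ suc) n) i) (sym e))) eq
    }

  Distinct : ℕ → (ℕ → Maybe ℤ) → ℕ → (ℕ → ℤ) → Set
  Distinct m f n Φ = ∀ t t′ → t ℕ.< t′ → t′ ℕ.< n → Filled (f t) → Filled (f t′) →
                     ¬ (Φ (suc t) ≡[mod m ] Φ (suc t′))

  simple-entries : ∀ m n f Φ → Potential value f n Φ → Distinct m f n Φ → SimpleMod m (entries f n)
  simple-entries m zero f Φ step distinct ()
  simple-entries m (suc n) f Φ step distinct
    with f 0 in f0 | step 0 (s≤s z≤n)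
       | simple-entries m n (f ∘ suc) (Φ ∘ suc) (λ t t<n → step (suc t) (s≤s t<n))
           (λ t t′ t<t′ t′<n → distinct (suc t) (suc t′) (s≤s t<t′) (s≤s t′<n))
       | partialSum-entries n (f ∘ suc) (Φ ∘ suc) (λ t t<n → step (suc t) (s≤s t<n))
  ... | nothing | e | ih | prefix = ih
  ... | just v | e | ih | prefix = λ
    { zero (suc j) _ d → let t , t<n , filled , eq = prefix j in
        distinct 0 (suc t) (s≤s z≤n) (s≤s t<n) (λ z → contradiction (trans (sym f0) z) λ ()) filled
          (subst (+ m ∣_) (shift (Φ 1) v (partialSum (entries (f ∘ suc) n) j) (Φ (suc (suc t))) eq) d)
    ; (suc i) (suc j) (s≤s i<j) d → ih i j i<j (subst (+ m ∣_) (cancel v _ _) d)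
    }
    where
    shift : ∀ x v y z → x + y ≡ z → (v + + 0) - (v + y) ≡ x - z
    shift x v y _ refl = solve (x ∷ v ∷ y ∷ [])
    cancel : ∀ v x y → (v + x) - (v + y) ≡ x - y
    cancel v x y = solve (v ∷ x ∷ y ∷ [])

  -- Rows and columns as cyclic sequences

  -- What distinctness asks of a row or a column. `x` and `y` are separate because in a row the two
  -- groups meet different columns. The conditions on `b` and `c` stop at `p`, the number of pairs;
  -- beyond it `b` may be a multiple of `K`.
  record Line (m p : ℕ) : Set where
    field
      K a b c : ℤ
      x y     : ℕ → ℤ
      K-low   : 0≤ K - + 4 * + m - + 1
      K-high  : 0≤ + 8 * + m + + 1 - K
      a+b+c   : a + b + c ≡ + 0
      a-low   : 0≤ + 5 * + m + a
      a-high  : 0≤ + 5 * + m - a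
      b-low   : 0≤ + 11 * + m + b
      b-high  : 0≤ + 12 * + m - b
      c-high  : 0≤ + 12 * + m - c
      a≢0     : a ≢ + 0
      a<K     : 0≤ K - a - + 1
      -K<a    : 0≤ K + a - + 1
      b≢      : ∀ t → t ℕ.≤ p → b ≢ - (K * + t)
      c≢      : ∀ t → t ℕ.≤ p → c ≢ K * + t
      x∈      : ∀ q → q ℕ.< p → InBlock (+ m) (+ q) (x q)
      y∈      : ∀ q → q ℕ.< p → InBlock (+ m) (+ q) (y q)

  -- Names for the partial sums from offset 0 on: `up q` and `down q` after q pairs of the first and
  -- second group, `high q` and `low q` inside pair q, `middle` between `c` and `b`. Distinctness
  -- splits into that of the names and that of the integers they denote.
  data Level : Set where
    high low up down : ℕ → Level
    middle           : Level

  -- There are three gaps because an empty cell has to know the level that it preserves.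
  data Kind : Set where
    a-cell b-cell c-cell gap₁ gap₂ gap₃  : Kind
    x-open x-close y-open y-close : ℕ → Kind

  NotGap : Kind → Set
  NotGap gap₁ = ⊥
  NotGap gap₂ = ⊥
  NotGap gap₃ = ⊥
  NotGap _    = ⊤

  module _ (p : ℕ) where

    ValidLevel : Level → Set
    ValidLevel (high q) = q ℕ.< p
    ValidLevel (low q)  = q ℕ.< p
    ValidLevel (up q)   = q ℕ.≤ p
    ValidLevel (down q) = q ℕ.≤ p
    ValidLevel middle   = ⊤

    Valid : Kind → Set
    Valid (x-open q)  = q ℕ.< p
    Valid (x-close q) = q ℕ.< p
    Valid (y-open q)  = q ℕ.< p
    Valid (y-close q) = q ℕ.< p
    Valid _           = ⊤

    -- Crossing a cell by increasing offset leads from `before` to `after`. A full turn starts and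
    -- ends at `down p`, whose value is 0.
    before after : Kind → Level
    before a-cell      = down p
    before (x-open q)  = up q
    before (x-close q) = high q
    before gap₁        = up p
    before c-cell      = up p
    before gap₂        = middle
    before b-cell      = middle
    before (y-open q)  = down q
    before (y-close q) = low q
    before gap₃        = down p
    after a-cell       = up 0
    after (x-open q)   = high q
    after (x-close q)  = up (suc q)
    after gap₁         = up p
    after c-cell       = middle
    after gap₂         = middle
    after b-cell       = down 0
    after (y-open q)   = low q
    after (y-close q)  = down (suc q)
    after gap₃         = down p

    private
      -- At q = p no further pair opens: `up p` precedes `c-cell` and `down p` precedes `a-cell`,
      -- hence the tests against `p`.
      before⁻¹ after⁻¹ : Level → Kind
      before⁻¹ (high q) = x-close q
      before⁻¹ (low q)  = y-close q
      before⁻¹ middle   = b-cell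
      before⁻¹ (up q) with q ℕ.<? p
      ... | yes _ = x-open q
      ... | no _  = c-cell
      before⁻¹ (down q) with q ℕ.<? p
      ... | yes _ = y-open q
      ... | no _  = a-cell
      after⁻¹ (high q)       = x-open q
      after⁻¹ (low q)        = y-open q
      after⁻¹ middle         = c-cell
      after⁻¹ (up zero)      = a-cell
      after⁻¹ (up (suc q))   = x-close q
      after⁻¹ (down zero)    = b-cell
      after⁻¹ (down (suc q)) = y-close q

      before⁻¹-before : ∀ k → Valid k → NotGap k → before⁻¹ (before k) ≡ k
      before⁻¹-before a-cell _ _ with p ℕ.<? p
      ... | yes p<p = contradiction p<p (ℕ.<-irrefl refl)
      ... | no _    = refl
      before⁻¹-before b-cell _ _ = refl
      before⁻¹-before c-cell _ _ with p ℕ.<? p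
      ... | yes p<p = contradiction p<p (ℕ.<-irrefl refl)
      ... | no _    = refl
      before⁻¹-before (x-open q) q<p _ with q ℕ.<? p
      ... | yes _   = refl
      ... | no q≮p = contradiction q<p q≮p
      before⁻¹-before (x-close q) _ _ = refl
      before⁻¹-before (y-open q) q<p _ with q ℕ.<? p
      ... | yes _   = refl
      ... | no q≮p = contradiction q<p q≮p
      before⁻¹-before (y-close q) _ _ = refl

      after⁻¹-after : ∀ k → NotGap k → after⁻¹ (after k) ≡ k
      after⁻¹-after a-cell _      = refl
      after⁻¹-after b-cell _      = refl
      after⁻¹-after c-cell _      = refl
      after⁻¹-after (x-open _) _  = refl
      after⁻¹-after (x-close _) _ = refl
      after⁻¹-after (y-open _) _  = refl
      after⁻¹-after (y-close _) _ = refl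

    -- Rows run through the offsets upwards and see the levels after their cells; columns run
    -- downwards and see the levels before them. Both maps must therefore separate filled cells.
    before-injective : ∀ k l → Valid k → Valid l → NotGap k → NotGap l → before k ≡ before l → k ≡ l
    before-injective k l vk vl fk fl e =
      trans (sym (before⁻¹-before k vk fk)) (trans (cong before⁻¹ e) (before⁻¹-before l vl fl))

    after-injective : ∀ k l → NotGap k → NotGap l → after k ≡ after l → k ≡ l
    after-injective k l fk fl e =
      trans (sym (after⁻¹-after k fk)) (trans (cong after⁻¹ e) (after⁻¹-after l fl))

    valid-before : ∀ k → Valid k → ValidLevel (before k)
    valid-before a-cell _        = ℕ.≤-refl
    valid-before b-cell _        = tt
    valid-before c-cell _        = ℕ.≤-refl
    valid-before gap₁ _          = ℕ.≤-refl
    valid-before gap₂ _          = tt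
    valid-before gap₃ _          = ℕ.≤-refl
    valid-before (x-open q) q<p  = ℕ.<⇒≤ q<p
    valid-before (x-close q) q<p = q<p
    valid-before (y-open q) q<p  = ℕ.<⇒≤ q<p
    valid-before (y-close q) q<p = q<p

    valid-after : ∀ k → Valid k → ValidLevel (after k)
    valid-after a-cell _        = z≤n
    valid-after b-cell _        = z≤n
    valid-after c-cell _        = tt
    valid-after gap₁ _          = ℕ.≤-refl
    valid-after gap₂ _          = tt
    valid-after gap₃ _          = ℕ.≤-refl
    valid-after (x-open q) q<p  = q<p
    valid-after (x-close q) q<p = q<p
    valid-after (y-open q) q<p  = q<p
    valid-after (y-close q) q<p = q<p

  hmod-value : ∀ m p → + hmod (4 ℕ.* m) (4 ℕ.* p ℕ.+ 3) ≡ + 32 * + m * + p + + 24 * + m + + 1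
  hmod-value m p = trans (cong (_+ + 1) product) (expand (+ m) (+ p))
    where
    product : + (2 ℕ.* (4 ℕ.* m) ℕ.* (4 ℕ.* p ℕ.+ 3)) ≡ (+ 2 * (+ 4 * + m)) * (+ 4 * + p + + 3)
    product = trans (ℤ.pos-* (2 ℕ.* (4 ℕ.* m)) (4 ℕ.* p ℕ.+ 3))
      (cong₂ _*_ (trans (ℤ.pos-* 2 (4 ℕ.* m)) (cong (+ 2 *_) (ℤ.pos-* 4 m))) (cong (_+ + 3) (ℤ.pos-* 4 p)))
    expand : ∀ M P → (+ 2 * (+ 4 * M)) * (+ 4 * P + + 3) + + 1 ≡ + 32 * M * P + + 24 * M + + 1
    expand M P = solve (M ∷ P ∷ [])

  module LineProperties {m p : ℕ} (1≤m : 1 ℕ.≤ m) (L : Line m p) where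
    open Line L
    open LineArithmetic (+ m) (+ p) K a b c (cast-≤ 1≤m) (nat p) K-low K-high a+b+c
      a-low a-high b-low b-high c-high

    level : Level → ℤ
    level (high q) = a - K * + q + x q
    level (low q)  = - (K * (+ p - + q)) - (y q + + 4 * + m)
    level (up q)   = a - K * + q
    level (down q) = - (K * (+ p - + q))
    level middle   = a + c - K * + p

    content : Kind → Maybe ℤ
    content a-cell      = just a
    content b-cell      = just b
    content c-cell      = just c
    content gap₁        = nothing
    content gap₂        = nothing
    content gap₃        = nothing
    content (x-open q)  = just (x q)
    content (x-close q) = just (- K - x q)
    content (y-open q)  = just (- (y q + + 4 * + m))
    content (y-close q) = just (K + (y q + + 4 * + m))

    filled⇒notGap : ∀ k → Filled (content k) → NotGap k
    filled⇒notGap gap₁ f        = f refl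
    filled⇒notGap gap₂ f        = f refl
    filled⇒notGap gap₃ f        = f refl
    filled⇒notGap a-cell _      = tt
    filled⇒notGap b-cell _      = tt
    filled⇒notGap c-cell _      = tt
    filled⇒notGap (x-open _) _  = tt
    filled⇒notGap (x-close _) _ = tt
    filled⇒notGap (y-open _) _  = tt
    filled⇒notGap (y-close _) _ = tt

    level-step : ∀ k → level (after p k) ≡ level (before p k) + value (content k)
    level-step a-cell = go K a (+ p)
      where
      go : ∀ K a P → a - K * + 0 ≡ - (K * (P - P)) + a
      go K a P = solve (K ∷ a ∷ P ∷ [])
    -- Here a + b + c = 0 enters: the level reached is a + b + c - K p.
    level-step b-cell = trans (go K a b c (+ p))
      (trans (cong (λ z → - z + (a + c - K * + p + b)) a+b+c) (ℤ.+-identityˡ _))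
      where
      go : ∀ K a b c P → - (K * (P - + 0)) ≡ - (a + b + c) + (a + c - K * P + b)
      go K a b c P = solve (K ∷ a ∷ b ∷ c ∷ P ∷ [])
    level-step c-cell = go K a c (+ p)
      where
      go : ∀ K a c P → a + c - K * P ≡ a - K * P + c
      go K a c P = solve (K ∷ a ∷ c ∷ P ∷ [])
    level-step gap₁ = sym (ℤ.+-identityʳ _)
    level-step gap₂ = sym (ℤ.+-identityʳ _)
    level-step gap₃ = sym (ℤ.+-identityʳ _)
    level-step (x-open q) = refl
    level-step (x-close q) = go K a (+ q) (x q)
      where
      go : ∀ K a Q X → a - K * (+ 1 + Q) ≡ a - K * Q + X + (- K - X)
      go K a Q X = solve (K ∷ a ∷ Q ∷ X ∷ [])
    level-step (y-open q) = refl
    level-step (y-close q) = go K (+ p) (+ q) (y q + + 4 * + m)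
      where
      go : ∀ K P Q Y → - (K * (P - (+ 1 + Q))) ≡ - (K * (P - Q)) - Y + (K + Y)
      go K P Q Y = solve (K ∷ P ∷ Q ∷ Y ∷ [])

    private
      c≢K[p-q] : ∀ q → q ℕ.≤ p → c ≢ K * (+ p - + q)
      c≢K[p-q] q q≤p e = c≢ (p ℕ.∸ q) (ℕ.m∸n≤m p q)
        (trans e (cong (K *_) (trans (ℤ.m-n≡m⊖n p q) (ℤ.⊖-≥ q≤p))))

      up-mid : ∀ q → q ℕ.≤ p → InMiddle (level (up q))
      up-mid q q≤p = up-middle (+ q) (nat q) (cast-≤ q≤p)

      down-mid : ∀ q → q ℕ.≤ p → InMiddle (level (down q))
      down-mid q q≤p = down-middle (+ q) (nat q) (cast-≤ q≤p)

      high≢ : ∀ q z → q ℕ.< p → InMiddle z → level (high q) ≢ z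
      high≢ q z q<p = high≢mid (+ q) (x q) z (nat q) (x∈ q q<p)

      low≢ : ∀ q z → q ℕ.< p → InMiddle z → level (low q) ≢ z
      low≢ q z q<p = low≢mid (+ q) (y q) z (nat q) (y∈ q q<p)

      high≢low′ : ∀ q r → q ℕ.< p → r ℕ.< p → level (high q) ≢ level (low r)
      high≢low′ q r q<p r<p = high≢low (+ q) (+ r) (x q) (y r) (nat q) (nat r) (x∈ q q<p) (y∈ r r<p)

    -- `high` levels lie above and `low` levels below the rest, and two levels of one sort are
    -- ordered by `q`. The remaining clashes, among `up`, `down` and `middle`, are each excluded by
    -- the condition on one of `a`, `b`, `c`.
    level-injective : ∀ u v → ValidLevel p u → ValidLevel p v → level u ≡ level v → u ≡ v
    level-injective (high q) (high r) q<p r<p e with ℕ.<-cmp q r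
    ... | tri< q<r _ _ = ⊥-elim (high≢high (+ q) (+ r) (x q) (x r) (cast-< q<r) (x∈ q q<p) (x∈ r r<p) e)
    ... | tri≈ _ q≡r _ = cong high q≡r
    ... | tri> _ _ r<q = ⊥-elim (high≢high (+ r) (+ q) (x r) (x q) (cast-< r<q) (x∈ r r<p) (x∈ q q<p) (sym e))
    level-injective (high q) (low r) q<p r<p e  = ⊥-elim (high≢low′ q r q<p r<p e)
    level-injective (high q) (up r) q<p r≤p e   = ⊥-elim (high≢ q _ q<p (up-mid r r≤p) e)
    level-injective (high q) (down r) q<p r≤p e = ⊥-elim (high≢ q _ q<p (down-mid r r≤p) e)
    level-injective (high q) middle q<p _ e     = ⊥-elim (high≢ q _ q<p middle-middle e)
    level-injective (low q) (high r) q<p r<p e  = ⊥-elim (high≢low′ r q r<p q<p (sym e))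
    level-injective (low q) (low r) q<p r<p e with ℕ.<-cmp q r
    ... | tri< q<r _ _ = ⊥-elim (low≢low (+ q) (+ r) (y q) (y r) (cast-< q<r) (y∈ q q<p) (y∈ r r<p) e)
    ... | tri≈ _ q≡r _ = cong low q≡r
    ... | tri> _ _ r<q = ⊥-elim (low≢low (+ r) (+ q) (y r) (y q) (cast-< r<q) (y∈ r r<p) (y∈ q q<p) (sym e))
    level-injective (low q) (up r) q<p r≤p e    = ⊥-elim (low≢ q _ q<p (up-mid r r≤p) e)
    level-injective (low q) (down r) q<p r≤p e  = ⊥-elim (low≢ q _ q<p (down-mid r r≤p) e)
    level-injective (low q) middle q<p _ e      = ⊥-elim (low≢ q _ q<p middle-middle e)
    level-injective (up q) (high r) q≤p r<p e   = ⊥-elim (high≢ r _ r<p (up-mid q q≤p) (sym e))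
    level-injective (up q) (low r) q≤p r<p e    = ⊥-elim (low≢ r _ r<p (up-mid q q≤p) (sym e))
    level-injective (up q) (up r) _ _ e with ℕ.<-cmp q r
    ... | tri< q<r _ _ = ⊥-elim (up≢up (+ q) (+ r) (cast-< q<r) e)
    ... | tri≈ _ q≡r _ = cong up q≡r
    ... | tri> _ _ r<q = ⊥-elim (up≢up (+ r) (+ q) (cast-< r<q) (sym e))
    level-injective (up q) (down r) _ _ e       = ⊥-elim (up≢down a≢0 a<K -K<a (+ q) (+ r) e)
    level-injective (up q) middle q≤p _ e       = ⊥-elim (c≢K[p-q] q q≤p (up≡middle (+ q) e))
    level-injective (down q) (high r) q≤p r<p e = ⊥-elim (high≢ r _ r<p (down-mid q q≤p) (sym e))
    level-injective (down q) (low r) q≤p r<p e  = ⊥-elim (low≢ r _ r<p (down-mid q q≤p) (sym e))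
    level-injective (down q) (up r) _ _ e       = ⊥-elim (up≢down a≢0 a<K -K<a (+ r) (+ q) (sym e))
    level-injective (down q) (down r) _ _ e with ℕ.<-cmp q r
    ... | tri< q<r _ _ = ⊥-elim (down≢down (+ q) (+ r) (cast-< q<r) e)
    ... | tri≈ _ q≡r _ = cong down q≡r
    ... | tri> _ _ r<q = ⊥-elim (down≢down (+ r) (+ q) (cast-< r<q) (sym e))
    level-injective (down q) middle q≤p _ e     = ⊥-elim (b≢ q q≤p (down≡middle (+ q) e))
    level-injective middle (high r) _ r<p e     = ⊥-elim (high≢ r _ r<p middle-middle (sym e))
    level-injective middle (low r) _ r<p e      = ⊥-elim (low≢ r _ r<p middle-middle (sym e))
    level-injective middle (up r) _ r≤p e       = ⊥-elim (c≢K[p-q] r r≤p (up≡middle (+ r) (sym e)))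
    level-injective middle (down r) _ r≤p e     = ⊥-elim (b≢ r r≤p (down≡middle (+ r) (sym e)))
    level-injective middle middle _ _ e         = refl

    private
      window : ∀ u → ValidLevel p u → InWindow (level u)
      window (high q) q<p = high-window (+ q) (x q) (nat q) (cast-< q<p) (x∈ q q<p)
      window (low q) q<p  = low-window (+ q) (y q) (nat q) (cast-< q<p) (y∈ q q<p)
      window (up q) q≤p   = mid-window _ (up-mid q q≤p)
      window (down q) q≤p = mid-window _ (down-mid q q≤p)
      window middle _     = mid-window _ middle-middle

      modulus : ℕ
      modulus = hmod (4 ℕ.* m) (4 ℕ.* p ℕ.+ 3)

      too-far : ∀ M P N u v → N ≡ + 32 * M * P + + 24 * M + + 1 →
                0≤ v + (+ 16 * M * P + + 13 * M) → 0≤ + 16 * M * P + + 11 * M - u → 0≤ u - v - N → ⊥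
      too-far M P _ u v refl floor ceil far =
        absurd 0 ((floor ⊕ ceil ⊕ far) ▸ solve (M ∷ P ∷ u ∷ v ∷ []))

      -- A nonzero difference divisible by the modulus is at least the modulus in size, and the ends
      -- of the window differ by one less.
      window-injective : ∀ u v → InWindow u → InWindow v → u ≡[mod modulus ] v → u ≡ v
      window-injective u v wu wv d with u - v in e
      ... | + zero = ℤ.i-j≡0⇒i≡j u v e
      ... | + suc k = ⊥-elim (too-far (+ m) (+ p) (+ modulus) u v (hmod-value m p) (InWindow.floor wv)
        (InWindow.ceil wu) (subst (λ z → 0≤ z - + modulus) (sym e) (cast-≤ (ℕ.∣⇒≤ d))))
      ... | -[1+ k ] = ⊥-elim (too-far (+ m) (+ p) (+ modulus) v u (hmod-value m p) (InWindow.floor wu)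
        (InWindow.ceil wv) (subst (λ z → 0≤ z - + modulus) (sym (flip u v (cong -_ e))) (cast-≤ (ℕ.∣⇒≤ d))))
        where
        flip : ∀ u v {z} → - (u - v) ≡ z → v - u ≡ z
        flip u v e = trans {j = - (u - v)} (solve (u ∷ v ∷ [])) e

    after-distinct : ∀ k l → Valid p k → Valid p l → NotGap k → NotGap l → k ≢ l →
                     ¬ (level (after p k) ≡[mod modulus ] level (after p l))
    after-distinct k l vk vl fk fl k≢l d = k≢l (after-injective p k l fk fl
      (level-injective _ _ (valid-after p k vk) (valid-after p l vl)
        (window-injective _ _ (window _ (valid-after p k vk)) (window _ (valid-after p l vl)) d)))

    before-distinct : ∀ k l → Valid p k → Valid p l → NotGap k → NotGap l → k ≢ l →
                      ¬ (level (before p k) ≡[mod modulus ] level (before p l))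
    before-distinct k l vk vl fk fl k≢l d = k≢l (before-injective p k l vk vl fk fl
      (level-injective _ _ (valid-before p k vk) (valid-before p l vl)
        (window-injective _ _ (window _ (valid-before p k vk)) (window _ (valid-before p l vl)) d)))

  -- Cells as functions of their cyclic offset

  data Parity : Set where
    even odd : ℕ → Parity

  next : Parity → Parity
  next (even q) = odd q
  next (odd q)  = even (suc q)

  parity : ℕ → Parity
  parity zero    = even 0
  parity (suc e) = next (parity e)

  fromParity : Parity → ℕ
  fromParity (even q) = 2 ℕ.* q
  fromParity (odd q)  = 1 ℕ.+ 2 ℕ.* q

  fromParity-next : ∀ π → fromParity (next π) ≡ suc (fromParity π)
  fromParity-next (even q) = refl
  fromParity-next (odd q)  = ℕ.*-suc 2 q

  fromParity-parity : ∀ e → fromParity (parity e) ≡ e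
  fromParity-parity zero    = refl
  fromParity-parity (suc e) = trans (fromParity-next (parity e)) (cong suc (fromParity-parity e))

  parity-even : ∀ q → parity (2 ℕ.* q) ≡ even q
  parity-even zero    = refl
  parity-even (suc q) = trans (cong parity (ℕ.*-suc 2 q)) (cong (λ π → next (next π)) (parity-even q))

  parity-odd : ∀ q → parity (1 ℕ.+ 2 ℕ.* q) ≡ odd q
  parity-odd q = cong next (parity-even q)

  -- The offset of the cell (i, j) is j - i mod n.
  module Offsets (μ p : ℕ) (p≤μ : p ℕ.≤ μ) where

    m n : ℕ
    m = suc μ
    n = 4 ℕ.* m

    xKind yKind : Parity → Kind
    xKind (even q) with q ℕ.<? p
    ... | yes _ = x-open q
    ... | no _  = gap₁
    xKind (odd q) with q ℕ.<? p
    ... | yes _ = x-close q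
    ... | no _  = gap₁
    yKind (even q) with q ℕ.<? p
    ... | yes _ = y-open q
    ... | no _  = gap₃
    yKind (odd q) with q ℕ.<? p
    ... | yes _ = y-close q
    ... | no _  = gap₃

    tailKind : ℕ → Kind
    tailKind 0                   = c-cell
    tailKind 1                   = gap₂
    tailKind 2                   = b-cell
    tailKind (suc (suc (suc e))) = yKind (parity e)

    -- Each group has 2μ offsets at its disposal, 1 to 2μ and 2μ + 4 to 4μ + 3; its 2p cells fit
    -- because p ≤ μ, and gaps fill the rest.
    kindOf : ℕ → Kind
    kindOf zero = a-cell
    kindOf (suc e) with e ℕ.<? 2 ℕ.* μ
    ... | yes _ = xKind (parity e)
    ... | no _  = tailKind (e ℕ.∸ 2 ℕ.* μ)

    private
      x-start : before p (xKind (even 0)) ≡ up 0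
      x-start with 0 ℕ.<? p
      ... | yes _ = refl
      ... | no ¬p = cong up (ℕ.n≤0⇒n≡0 (ℕ.≮⇒≥ ¬p))

      y-start : before p (yKind (even 0)) ≡ down 0
      y-start with 0 ℕ.<? p
      ... | yes _ = refl
      ... | no ¬p = cong down (ℕ.n≤0⇒n≡0 (ℕ.≮⇒≥ ¬p))

      x-link : ∀ π → before p (xKind (next π)) ≡ after p (xKind π)
      x-link (even q) with q ℕ.<? p
      ... | yes _ = refl
      ... | no _  = refl
      x-link (odd q) with q ℕ.<? p | suc q ℕ.<? p
      ... | yes _   | yes _    = refl
      ... | yes q<p | no 1+q≮p = cong up (ℕ.≤-antisym (ℕ.≮⇒≥ 1+q≮p) q<p)
      ... | no q≮p  | yes 1+q<p = contradiction (ℕ.<⇒≤ 1+q<p) q≮p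
      ... | no _    | no _     = refl

      y-link : ∀ π → before p (yKind (next π)) ≡ after p (yKind π)
      y-link (even q) with q ℕ.<? p
      ... | yes _ = refl
      ... | no _  = refl
      y-link (odd q) with q ℕ.<? p | suc q ℕ.<? p
      ... | yes _   | yes _    = refl
      ... | yes q<p | no 1+q≮p = cong down (ℕ.≤-antisym (ℕ.≮⇒≥ 1+q≮p) q<p)
      ... | no q≮p  | yes 1+q<p = contradiction (ℕ.<⇒≤ 1+q<p) q≮p
      ... | no _    | no _     = refl

      x-end : before p (xKind (parity (2 ℕ.* μ))) ≡ up p
      x-end rewrite parity-even μ with μ ℕ.<? p
      ... | yes μ<p = contradiction μ<p (ℕ.≤⇒≯ p≤μ)
      ... | no _    = refl

      y-end : before p (yKind (parity (2 ℕ.* μ))) ≡ down p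
      y-end rewrite parity-even μ with μ ℕ.<? p
      ... | yes μ<p = contradiction μ<p (ℕ.≤⇒≯ p≤μ)
      ... | no _    = refl

      tail-link : ∀ t → before p (tailKind (suc t)) ≡ after p (tailKind t)
      tail-link 0 = refl
      tail-link 1 = refl
      tail-link 2 = y-start
      tail-link (suc (suc (suc e))) = y-link (parity e)

    -- This makes `level` a potential along the offsets: neighbouring cells share the level between
    -- them.
    kindOf-link : ∀ d → before p (kindOf (suc d)) ≡ after p (kindOf d)
    kindOf-link zero with 0 ℕ.<? 2 ℕ.* μ
    ... | yes _ = x-start
    ... | no ¬p rewrite ℕ.0∸n≡0 (2 ℕ.* μ) = cong up (ℕ.n≤0⇒n≡0
            (ℕ.≤-trans p≤μ (ℕ.≤-trans (ℕ.m≤n*m μ 2) (ℕ.≮⇒≥ ¬p))))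
    kindOf-link (suc e) with e ℕ.<? 2 ℕ.* μ | suc e ℕ.<? 2 ℕ.* μ
    ... | yes _   | yes _   = x-link (parity e)
    -- The next cell is `c-cell`. It is compared with the gap that `xKind` would put at its place,
    -- as `up p` precedes both.
    ... | yes e<s | no ¬e   = trans (cong (λ z → before p (tailKind (z ℕ.∸ 2 ℕ.* μ))) e≡)
                                (trans (cong (λ z → before p (tailKind z)) (ℕ.n∸n≡0 (2 ℕ.* μ)))
                                  (trans (sym x-end) (trans (cong (λ z → before p (xKind (parity z))) (sym e≡))
                                    (x-link (parity e)))))
      where
      e≡ : suc e ≡ 2 ℕ.* μ
      e≡ = ℕ.≤-antisym e<s (ℕ.≮⇒≥ ¬e)
    ... | no e≮s  | yes e<s = contradiction (ℕ.<⇒≤ e<s) e≮s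
    ... | no e≮s  | no _    = trans (cong (λ z → before p (tailKind z)) (ℕ.+-∸-assoc 1 (ℕ.≮⇒≥ e≮s)))
                                (tail-link (e ℕ.∸ 2 ℕ.* μ))

    private
      tail-offset : ∀ t → kindOf (suc (t ℕ.+ 2 ℕ.* μ)) ≡ tailKind t
      tail-offset t with t ℕ.+ 2 ℕ.* μ ℕ.<? 2 ℕ.* μ
      ... | yes t+s<s = contradiction t+s<s (ℕ.≤⇒≯ (ℕ.m≤n+m (2 ℕ.* μ) t))
      ... | no _      = cong tailKind (ℕ.m+n∸n≡m t (2 ℕ.* μ))

      head-offset : ∀ e → e ℕ.< 2 ℕ.* μ → kindOf (suc e) ≡ xKind (parity e)
      head-offset e e<s with e ℕ.<? 2 ℕ.* μ
      ... | yes _  = refl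
      ... | no e≮s = contradiction e<s e≮s

    -- Offset `n` is no cell of the line; `kindOf` continues with a gap there, at the level `down p`
    -- that also precedes offset 0.
    kindOf-period : before p (kindOf n) ≡ before p (kindOf 0)
    kindOf-period = trans (cong (λ z → before p (kindOf (suc z))) (size μ))
                      (trans (cong (before p) (tail-offset (3 ℕ.+ 2 ℕ.* μ))) y-end)
      where
      size : ∀ μ → μ ℕ.+ 3 ℕ.* suc μ ≡ 3 ℕ.+ 2 ℕ.* μ ℕ.+ 2 ℕ.* μ
      size μ = ℕ-Solver.solve (μ ∷ [])

    valid-kindOf : ∀ d → Valid p (kindOf d)
    valid-kindOf zero = tt
    valid-kindOf (suc e) with e ℕ.<? 2 ℕ.* μ
    ... | yes _ = valid-x (parity e)
      where
      valid-x : ∀ π → Valid p (xKind π)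
      valid-x (even q) with q ℕ.<? p
      ... | yes q<p = q<p
      ... | no _    = tt
      valid-x (odd q) with q ℕ.<? p
      ... | yes q<p = q<p
      ... | no _    = tt
    ... | no _ = valid-tail (e ℕ.∸ 2 ℕ.* μ)
      where
      valid-y : ∀ π → Valid p (yKind π)
      valid-y (even q) with q ℕ.<? p
      ... | yes q<p = q<p
      ... | no _    = tt
      valid-y (odd q) with q ℕ.<? p
      ... | yes q<p = q<p
      ... | no _    = tt
      valid-tail : ∀ t → Valid p (tailKind t)
      valid-tail 0 = tt
      valid-tail 1 = tt
      valid-tail 2 = tt
      valid-tail (suc (suc (suc e))) = valid-y (parity e)

    offsetOf : Kind → ℕ
    offsetOf a-cell      = 0
    offsetOf (x-open q)  = suc (2 ℕ.* q)
    offsetOf (x-close q) = suc (suc (2 ℕ.* q))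
    offsetOf c-cell      = suc (0 ℕ.+ 2 ℕ.* μ)
    offsetOf b-cell      = suc (2 ℕ.+ 2 ℕ.* μ)
    offsetOf (y-open q)  = suc (3 ℕ.+ 2 ℕ.* q ℕ.+ 2 ℕ.* μ)
    offsetOf (y-close q) = suc (4 ℕ.+ 2 ℕ.* q ℕ.+ 2 ℕ.* μ)
    -- A default for gaps; whatever recovers a kind or an offset assumes `NotGap`.
    offsetOf _           = 0

    offsetOf-kindOf : ∀ d → NotGap (kindOf d) → offsetOf (kindOf d) ≡ d
    offsetOf-kindOf zero _ = refl
    offsetOf-kindOf (suc e) with e ℕ.<? 2 ℕ.* μ
    ... | yes _ = λ f → trans (x-offset (parity e) f) (cong suc (fromParity-parity e))
      where
      x-offset : ∀ π → NotGap (xKind π) → offsetOf (xKind π) ≡ suc (fromParity π)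
      x-offset (even q) f with q ℕ.<? p
      ... | yes _ = refl
      x-offset (odd q) f with q ℕ.<? p
      ... | yes _ = refl
    ... | no e≮s = λ f → trans (tail-offset′ (e ℕ.∸ 2 ℕ.* μ) f) (cong suc (ℕ.m∸n+n≡m (ℕ.≮⇒≥ e≮s)))
      where
      y-offset : ∀ π → NotGap (yKind π) → offsetOf (yKind π) ≡ suc (3 ℕ.+ fromParity π ℕ.+ 2 ℕ.* μ)
      y-offset (even q) f with q ℕ.<? p
      ... | yes _ = refl
      y-offset (odd q) f with q ℕ.<? p
      ... | yes _ = refl
      tail-offset′ : ∀ t → NotGap (tailKind t) → offsetOf (tailKind t) ≡ suc (t ℕ.+ 2 ℕ.* μ)
      tail-offset′ 0 _ = refl
      tail-offset′ 2 _ = refl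
      tail-offset′ (suc (suc (suc e))) f =
        trans (y-offset (parity e) f) (cong (λ z → suc (3 ℕ.+ z ℕ.+ 2 ℕ.* μ)) (fromParity-parity e))

    kindOf-offsetOf : ∀ k → Valid p k → NotGap k → kindOf (offsetOf k) ≡ k
    kindOf-offsetOf a-cell _ _ = refl
    kindOf-offsetOf c-cell _ _ = tail-offset 0
    kindOf-offsetOf b-cell _ _ = tail-offset 2
    kindOf-offsetOf (x-open q) q<p _ = trans (head-offset _ (ℕ.*-monoʳ-< 2 (ℕ.≤-trans q<p p≤μ)))
      (trans (cong xKind (parity-even q)) step)
      where
      step : xKind (even q) ≡ x-open q
      step with q ℕ.<? p
      ... | yes _  = refl
      ... | no q≮p = contradiction q<p q≮p
    kindOf-offsetOf (x-close q) q<p _ =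
      trans (head-offset _ (ℕ.≤-trans (ℕ.≤-reflexive (sym (ℕ.*-suc 2 q))) (ℕ.*-monoʳ-≤ 2 (ℕ.≤-trans q<p p≤μ))))
      (trans (cong xKind (parity-odd q)) step)
      where
      step : xKind (odd q) ≡ x-close q
      step with q ℕ.<? p
      ... | yes _  = refl
      ... | no q≮p = contradiction q<p q≮p
    kindOf-offsetOf (y-open q) q<p _ = trans (tail-offset (3 ℕ.+ 2 ℕ.* q)) (trans (cong yKind (parity-even q)) step)
      where
      step : yKind (even q) ≡ y-open q
      step with q ℕ.<? p
      ... | yes _  = refl
      ... | no q≮p = contradiction q<p q≮p
    kindOf-offsetOf (y-close q) q<p _ = trans (tail-offset (4 ℕ.+ 2 ℕ.* q)) (trans (cong yKind (parity-odd q)) step)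
      where
      step : yKind (odd q) ≡ y-close q
      step with q ℕ.<? p
      ... | yes _  = refl
      ... | no q≮p = contradiction q<p q≮p


    private
      n≡ : n ≡ 4 ℕ.+ 2 ℕ.* μ ℕ.+ 2 ℕ.* μ
      n≡ = size μ
        where
        size : ∀ μ → 4 ℕ.* suc μ ≡ 4 ℕ.+ 2 ℕ.* μ ℕ.+ 2 ℕ.* μ
        size μ = ℕ-Solver.solve (μ ∷ [])

      early<n : ∀ {d} → d ℕ.≤ 3 ℕ.+ 2 ℕ.* μ → d ℕ.< n
      early<n d≤ = ℕ.≤-trans (s≤s d≤) (ℕ.≤-trans (ℕ.m≤m+n _ _) (ℕ.≤-reflexive (sym n≡)))

      late<n : ∀ {d} q → q ℕ.< p → d ℕ.≤ 5 ℕ.+ 2 ℕ.* q ℕ.+ 2 ℕ.* μ → d ℕ.< n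
      late<n q q<p d≤ = ℕ.≤-trans (s≤s d≤) (ℕ.≤-trans (ℕ.≤-reflexive (cong (λ z → 4 ℕ.+ z ℕ.+ 2 ℕ.* μ) (sym (ℕ.*-suc 2 q))))
        (ℕ.≤-trans (ℕ.+-monoˡ-≤ (2 ℕ.* μ) (ℕ.+-monoʳ-≤ 4 (ℕ.*-monoʳ-≤ 2 (ℕ.≤-trans q<p p≤μ)))) (ℕ.≤-reflexive (sym n≡))))

    offsetOf<n : ∀ k → Valid p k → offsetOf k ℕ.< n
    offsetOf<n a-cell _        = s≤s z≤n
    offsetOf<n b-cell _        = early<n ℕ.≤-refl
    offsetOf<n c-cell _        = early<n (ℕ.m≤n+m _ 2)
    offsetOf<n gap₁ _          = s≤s z≤n
    offsetOf<n gap₂ _          = s≤s z≤n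
    offsetOf<n gap₃ _          = s≤s z≤n
    offsetOf<n (x-open q) q<p  = late<n q q<p (s≤s (ℕ.≤-trans (ℕ.m≤n+m _ 4) (ℕ.m≤m+n _ _)))
    offsetOf<n (x-close q) q<p = late<n q q<p (s≤s (s≤s (ℕ.≤-trans (ℕ.m≤n+m _ 3) (ℕ.m≤m+n _ _))))
    offsetOf<n (y-open q) q<p  = late<n q q<p (ℕ.n≤1+n _)
    offsetOf<n (y-close q) q<p = late<n q q<p ℕ.≤-refl

    -- One subtraction serves as the remainder mod n, because the walks stay at positions up to 2n.
    -- At 2n itself the result is n, not 0.
    reduce : ℕ → ℕ
    reduce x with x ℕ.<? n
    ... | yes _ = x
    ... | no _  = x ℕ.∸ n

    reduce-< : ∀ {x} → x ℕ.< n → reduce x ≡ x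
    reduce-< {x} x<n with x ℕ.<? n
    ... | yes _  = refl
    ... | no x≮n = contradiction x<n x≮n

    reduce-≥ : ∀ x → reduce (n ℕ.+ x) ≡ x
    reduce-≥ x with n ℕ.+ x ℕ.<? n
    ... | yes n+x<n = contradiction n+x<n (ℕ.≤⇒≯ (ℕ.m≤m+n n x))
    ... | no _      = ℕ.m+n∸m≡n n x

    reduce<n : ∀ {x} → x ℕ.< n ℕ.+ n → reduce x ℕ.< n
    reduce<n {x} x<2n with x ℕ.<? n
    ... | yes x<n = x<n
    ... | no x≮n  = ℕ.+-cancelʳ-< n (x ℕ.∸ n) n (subst (ℕ._< n ℕ.+ n) (sym (ℕ.m∸n+n≡m (ℕ.≮⇒≥ x≮n))) x<2n)

    kindAt : ℕ → Kind
    kindAt x = kindOf (reduce x)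

    kindAt-link : ∀ x → before p (kindAt (suc x)) ≡ after p (kindAt x)
    kindAt-link x with ℕ.<-cmp (suc x) n
    ... | tri< 1+x<n _ _ = trans (cong (λ z → before p (kindOf z)) (reduce-< 1+x<n))
            (trans (kindOf-link x) (cong (λ z → after p (kindOf z)) (sym (reduce-< (ℕ.<⇒≤ 1+x<n)))))
    ... | tri≈ _ 1+x≡n _ = trans (cong (λ z → before p (kindOf z)) wrap)
            (trans (sym kindOf-period) (trans (cong (λ z → before p (kindOf z)) (sym 1+x≡n))
              (trans (kindOf-link x) (cong (λ z → after p (kindOf z)) (sym (reduce-< (ℕ.≤-reflexive 1+x≡n)))))))
      where
      wrap : reduce (suc x) ≡ 0
      wrap = trans (cong reduce (trans 1+x≡n (sym (ℕ.+-identityʳ n)))) (reduce-≥ 0)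
    ... | tri> _ _ (s≤s n≤x) = subst (λ z → before p (kindAt (suc z)) ≡ after p (kindAt z)) (ℕ.m+[n∸m]≡n n≤x)
            (past (x ℕ.∸ n))
      where
      past : ∀ y → before p (kindAt (suc (n ℕ.+ y))) ≡ after p (kindAt (n ℕ.+ y))
      past y = trans (cong (λ z → before p (kindOf z)) (trans (cong reduce (sym (ℕ.+-suc n y))) (reduce-≥ (suc y))))
                 (trans (kindOf-link y) (cong (λ z → after p (kindOf z)) (sym (reduce-≥ y))))

    -- At x = n the kinds differ, `kindOf n` against `kindOf 0`, since `reduce` subtracts once; the
    -- level before them still agrees.
    kindAt-before-period : ∀ {x} → x ℕ.≤ n → before p (kindAt (n ℕ.+ x)) ≡ before p (kindAt x)
    kindAt-before-period {x} x≤n with ℕ.m≤n⇒m<n∨m≡n x≤n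
    ... | inj₁ x<n = cong (λ z → before p (kindOf z)) (trans (reduce-≥ x) (sym (reduce-< x<n)))
    ... | inj₂ refl = trans (cong (λ z → before p (kindOf z)) (reduce-≥ n))
            (trans kindOf-period (cong (λ z → before p (kindOf z)) (sym wrap)))
      where
      wrap : reduce n ≡ 0
      wrap = trans (cong reduce (sym (ℕ.+-identityʳ n))) (reduce-≥ 0)

    private
      reduce-distinct : ∀ {x y} → x ℕ.< y → y ℕ.< x ℕ.+ n → y ℕ.< n ℕ.+ n → reduce x ≢ reduce y
      reduce-distinct {x} {y} x<y y<x+n y<2n e with x ℕ.<? n | y ℕ.<? n
      ... | yes _   | yes _   = ℕ.<⇒≢ x<y e
      ... | yes _   | no y≮n  = ℕ.<⇒≢ (ℕ.+-cancelʳ-< n (y ℕ.∸ n) x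
                                  (ℕ.≤-trans (ℕ.≤-reflexive (cong suc (ℕ.m∸n+n≡m (ℕ.≮⇒≥ y≮n)))) y<x+n)) (sym e)
      ... | no x≮n  | yes y<n = x≮n (ℕ.<-trans x<y y<n)
      ... | no x≮n  | no y≮n  = ℕ.<⇒≢ x<y (ℕ.∸-cancelʳ-≡ (ℕ.≮⇒≥ x≮n) (ℕ.≮⇒≥ y≮n) e)

    -- Positions less than `n` apart have different offsets, and the kind of a filled cell
    -- determines its offset.
    kindAt-distinct : ∀ {x y} → x ℕ.< y → y ℕ.< x ℕ.+ n → y ℕ.< n ℕ.+ n →
                      NotGap (kindAt x) → NotGap (kindAt y) → kindAt x ≢ kindAt y
    kindAt-distinct {x} {y} x<y y<x+n y<2n fx fy e = reduce-distinct x<y y<x+n y<2n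
      (trans (sym (offsetOf-kindOf (reduce x) fx)) (trans (cong offsetOf e) (offsetOf-kindOf (reduce y) fy)))

    -- Number of filled cells before a level when counting starts at offset 0; down p, the level
    -- both before offset 0 and after offset n - 1, gets the full count, and lap corrects the wrap.
    rank : Level → ℤ
    rank (up q)   = + 1 + + 2 * + q
    rank (high q) = + 2 + + 2 * + q
    rank middle   = + 2 + + 2 * + p
    rank (down q) = + 3 + + 2 * + p + + 2 * + q
    rank (low q)  = + 4 + + 2 * + p + + 2 * + q

    lap : ℕ → ℤ
    lap x with n ℕ.<? x
    ... | yes _ = + 4 * + p + + 3
    ... | no _  = + 0

    lap-≤ : ∀ {x} → x ℕ.≤ n → lap x ≡ + 0
    lap-≤ {x} x≤n with n ℕ.<? x
    ... | yes n<x = contradiction n<x (ℕ.≤⇒≯ x≤n)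
    ... | no _    = refl

    lap-> : ∀ {x} → n ℕ.< x → lap x ≡ + 4 * + p + + 3
    lap-> {x} n<x with n ℕ.<? x
    ... | yes _   = refl
    ... | no n≮x = contradiction n<x n≮x

    counter : ℕ → ℤ
    counter x = rank (before p (kindAt x)) + lap x

    module _ (L : Line m p) where
      open LineProperties (s≤s z≤n) L

      private
        rank-step : ∀ k → k ≢ a-cell → rank (after p k) ≡ rank (before p k) + count (content k)
        rank-step a-cell k≢ = contradiction refl k≢
        rank-step gap₁ _ = sym (ℤ.+-identityʳ _)
        rank-step gap₂ _ = sym (ℤ.+-identityʳ _)
        rank-step gap₃ _ = sym (ℤ.+-identityʳ _)
        rank-step c-cell _ = go (+ p)
          where
          go : ∀ P → + 2 + + 2 * P ≡ + 1 + + 2 * P + + 1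
          go P = solve (P ∷ [])
        rank-step b-cell _ = go (+ p)
          where
          go : ∀ P → + 3 + + 2 * P + + 2 * + 0 ≡ + 2 + + 2 * P + + 1
          go P = solve (P ∷ [])
        rank-step (x-open q) _ = go (+ q)
          where
          go : ∀ Q → + 2 + + 2 * Q ≡ + 1 + + 2 * Q + + 1
          go Q = solve (Q ∷ [])
        rank-step (x-close q) _ = go (+ q)
          where
          go : ∀ Q → + 1 + + 2 * (+ 1 + Q) ≡ + 2 + + 2 * Q + + 1
          go Q = solve (Q ∷ [])
        rank-step (y-open q) _ = go (+ p) (+ q)
          where
          go : ∀ P Q → + 4 + + 2 * P + + 2 * Q ≡ + 3 + + 2 * P + + 2 * Q + + 1
          go P Q = solve (P ∷ Q ∷ [])
        rank-step (y-close q) _ = go (+ p) (+ q)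
          where
          go : ∀ P Q → + 3 + + 2 * P + + 2 * (+ 1 + Q) ≡ + 4 + + 2 * P + + 2 * Q + + 1
          go P Q = solve (P ∷ Q ∷ [])

        a-cell-offset : ∀ d → kindOf d ≡ a-cell → d ≡ 0
        a-cell-offset d e = trans (sym (offsetOf-kindOf d (subst NotGap (sym e) tt))) (cong offsetOf e)

        counter-step-same : ∀ x → kindAt x ≢ a-cell → lap (suc x) ≡ lap x →
                            counter (suc x) ≡ counter x + count (content (kindAt x))
        counter-step-same x k≢ l = trans (cong₂ _+_ (trans (cong rank (kindAt-link x)) (rank-step _ k≢)) l)
          (swap (rank (before p (kindAt x))) (count (content (kindAt x))) (lap x))
          where
          swap : ∀ r w z → r + w + z ≡ r + z + w
          swap r w z = solve (r ∷ w ∷ z ∷ [])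

      -- Across `a-cell` the `rank` falls from 4p + 3 to 1. At x = n the jump of `lap` turns this
      -- into a gain of 1; at x = 0 there is no such jump, so the count begins at 1.
      counter-step : ∀ x → 1 ℕ.≤ x → x ℕ.< n ℕ.+ n → counter (suc x) ≡ counter x + count (content (kindAt x))
      counter-step x 1≤x x<2n with ℕ.<-cmp x n
      ... | tri< x<n _ _ = counter-step-same x
              (λ e → ℕ.<⇒≢ 1≤x (sym (trans (sym (reduce-< x<n)) (a-cell-offset _ e))))
              (trans (lap-≤ x<n) (sym (lap-≤ (ℕ.<⇒≤ x<n))))
      ... | tri> _ _ n<x = counter-step-same x
              (λ e → ℕ.m>n⇒m∸n≢0 n<x (trans (sym (trans (cong reduce (sym (ℕ.m+[n∸m]≡n (ℕ.<⇒≤ n<x)))) (reduce-≥ _)))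
                (a-cell-offset _ e)))
              (trans (lap-> (ℕ.m≤n⇒m≤1+n n<x)) (sym (lap-> n<x)))
      ... | tri≈ _ refl _ = trans (cong₂ _+_ (trans (cong rank (trans (kindAt-link n) (cong (after p) at-n))) refl) (lap-> ℕ.≤-refl))
              (trans (total (+ p)) (cong₂ _+_ (cong₂ _+_ (cong (λ k → rank (before p k)) (sym at-n)) (sym (lap-≤ ℕ.≤-refl)))
                (cong (λ k → count (content k)) (sym at-n))))
        where
        at-n : kindAt n ≡ a-cell
        at-n = cong kindOf (trans (cong reduce (sym (ℕ.+-identityʳ n))) (reduce-≥ 0))
        total : ∀ P → + 1 + + 2 * + 0 + (+ 4 * P + + 3) ≡ + 3 + + 2 * P + + 2 * P + + 0 + + 1
        total P = solve (P ∷ [])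

  -- Walking once around a line

  record Good (n k : ℕ) (l : List ℤ) : Set where
    field
      size   : length l ≡ k
      total  : sumℤ l ≡ + 0
      simple : SimpleMod (hmod n k) l

  module Walks (μ p : ℕ) (p≤μ : p ℕ.≤ μ) (L : Line (suc μ) p) where
    open Offsets μ p p≤μ
    open LineProperties (s≤s z≤n) L

    private
      size-from : ∀ f Φ → Potential count f n Φ → Φ n ≡ Φ 0 + (+ 4 * + p + + 3) →
                  length (entries f n) ≡ 4 ℕ.* p ℕ.+ 3
      size-from f Φ step e = ℤ.+-injective (trans (length-entries n f Φ step)
        (trans (cancel (Φ 0) (Φ n) _ e) (cong (_+ + 3) (sym (ℤ.pos-* 4 p)))))
        where
        cancel : ∀ x y k → y ≡ x + k → y - x ≡ k
        cancel x _ k refl = solve (x ∷ k ∷ [])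

      total-from : ∀ f Φ → Potential value f n Φ → Φ n ≡ Φ 0 → sumℤ (entries f n) ≡ + 0
      total-from f Φ step e = trans (sum-entries n f Φ step) (trans (cong (_- Φ 0) e) (ℤ.+-inverseʳ (Φ 0)))

      negate : ∀ b a v → a ≡ b + v → - b ≡ - a + v
      negate b _ v refl = solve (b ∷ v ∷ [])

      level-value : ∀ x → level (before p (kindAt (suc x))) ≡ level (before p (kindAt x)) + value (content (kindAt x))
      level-value x = trans (cong level (kindAt-link x)) (level-step (kindAt x))

      counter-lap : ∀ {x} → before p (kindAt (n ℕ.+ x)) ≡ before p (kindAt x) → n ℕ.< n ℕ.+ x → x ℕ.≤ n →
                    counter (n ℕ.+ x) ≡ counter x + (+ 4 * + p + + 3)
      counter-lap {x} e n<n+x x≤n =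
        trans (cong₂ _+_ (cong rank e) (lap-> n<n+x))
          (cong (_+ (+ 4 * + p + + 3)) (sym (trans (cong (λ z → rank (before p (kindAt x)) + z) (lap-≤ x≤n)) (ℤ.+-identityʳ (rank (before p (kindAt x)))))))

    -- The cell of row `i` in column t has offset t - i mod n, read at position t + (n - i); the
    -- walk starts between 1 and n and takes n steps.
    ascending : ∀ i → i ℕ.< n → Good n (4 ℕ.* p ℕ.+ 3) (entries (λ t → content (kindAt (t ℕ.+ (n ℕ.∸ i)))) n)
    ascending i i<n = record
      { size   = size-from f (λ t → counter (at t))
                   (λ t t<n → counter-step L (at t) (ℕ.≤-trans 1≤s (ℕ.m≤n+m s t)) (at<2n t<n))
                   (counter-lap (kindAt-before-period s≤n) (ℕ.≤-trans (ℕ.≤-reflexive (sym (ℕ.+-comm n 1))) (ℕ.+-monoʳ-≤ n 1≤s)) s≤n)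
      ; total  = total-from f Φ (λ t _ → level-value (at t)) (cong level (kindAt-before-period s≤n))
      ; simple = simple-entries _ n f Φ (λ t _ → level-value (at t)) distinct
      }
      where
      s : ℕ
      s = n ℕ.∸ i
      at : ℕ → ℕ
      at t = t ℕ.+ s
      f : ℕ → Maybe ℤ
      f t = content (kindAt (at t))
      Φ : ℕ → ℤ
      Φ t = level (before p (kindAt (at t)))
      1≤s : 1 ℕ.≤ s
      1≤s = ℕ.m<n⇒0<n∸m i<n
      s≤n : s ℕ.≤ n
      s≤n = ℕ.m∸n≤m n i
      at<2n : ∀ {t} → t ℕ.< n → at t ℕ.< n ℕ.+ n
      at<2n t<n = ℕ.+-mono-<-≤ t<n s≤n
      distinct : Distinct (hmod n (4 ℕ.* p ℕ.+ 3)) f n Φ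
      distinct t t′ t<t′ t′<n ft ft′ d =
        after-distinct (kindAt (at t)) (kindAt (at t′)) (valid-kindOf (reduce (at t))) (valid-kindOf (reduce (at t′))) gt gt′
          (kindAt-distinct (ℕ.+-monoˡ-< s t<t′) (near t<t′ t′<n) (at<2n t′<n) gt gt′)
          (subst (+ hmod n (4 ℕ.* p ℕ.+ 3) ∣_)
            (cong₂ (λ u v → level u - level v) (kindAt-link (at t)) (kindAt-link (at t′))) d)
        where
        gt  = filled⇒notGap (kindAt (at t)) ft
        gt′ = filled⇒notGap (kindAt (at t′)) ft′
        near : ∀ {t t′} → t ℕ.< t′ → t′ ℕ.< n → at t′ ℕ.< at t ℕ.+ n
        near {t} {t′} _ t′<n = ℕ.<-≤-trans (ℕ.+-monoˡ-< s t′<n)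
          (ℕ.≤-trans (ℕ.≤-reflexive (ℕ.+-comm n s)) (ℕ.+-monoˡ-≤ n (ℕ.m≤n+m s t)))

    -- The offset falls as the row index grows, so the levels are met backwards. The sign in `Φ`
    -- restores the entries as steps, and the level reached after a cell is the one before it in
    -- offset order.
    descending : ∀ j → j ℕ.< n → Good n (4 ℕ.* p ℕ.+ 3) (entries (λ t → content (kindAt (j ℕ.+ (n ℕ.∸ t)))) n)
    descending j j<n = record
      { size   = size-from f (λ t → - counter (suc (at t)))
                   (λ t t<n → negate _ _ _ (trans (counter-step L (at t) (1≤at t<n) (at<2n t<n))
                     (cong (λ z → counter z + count (f t)) (at-suc t<n))))
                   (trans (cong (λ z → - counter (suc z)) at-n)
                     (sym (trans (cong (λ z → - counter (suc z) + (+ 4 * + p + + 3)) at-0)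
                       (flip (counter (suc j)) (counter (suc (n ℕ.+ j))) _
                         (trans (cong counter (sym (ℕ.+-suc n j))) (counter-lap period (ℕ.m<m+n n (s≤s z≤n)) j<n))))))
      ; total  = total-from f Φ step (trans (cong (λ z → - level (after p (kindAt z))) at-n)
                   (cong (λ k → - level (after p k)) (sym (trans (cong kindAt at-0) same))))
      ; simple = simple-entries _ n f Φ step distinct
      }
      where
      at : ℕ → ℕ
      at t = j ℕ.+ (n ℕ.∸ t)
      f : ℕ → Maybe ℤ
      f t = content (kindAt (at t))
      Φ : ℕ → ℤ
      Φ t = - level (after p (kindAt (at t)))
      at-n : at n ≡ j
      at-n = trans (cong (λ z → j ℕ.+ z) (ℕ.n∸n≡0 n)) (ℕ.+-identityʳ j)
      at-0 : at 0 ≡ n ℕ.+ j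
      at-0 = ℕ.+-comm j n
      at-suc : ∀ {t} → t ℕ.< n → at t ≡ suc (at (suc t))
      at-suc {t} t<n = trans (cong (λ z → j ℕ.+ z) (ℕ.+-∸-assoc 1 t<n)) (ℕ.+-suc j _)
      same : kindAt (n ℕ.+ j) ≡ kindAt j
      same = cong kindOf (trans (reduce-≥ j) (sym (reduce-< j<n)))
      period : before p (kindAt (n ℕ.+ suc j)) ≡ before p (kindAt (suc j))
      period = kindAt-before-period j<n
      1≤at : ∀ {t} → t ℕ.< n → 1 ℕ.≤ at t
      1≤at {t} t<n = ℕ.≤-trans (ℕ.m<n⇒0<n∸m t<n) (ℕ.m≤n+m _ j)
      at<2n : ∀ {t} → t ℕ.< n → at t ℕ.< n ℕ.+ n
      at<2n {t} _ = ℕ.+-mono-<-≤ j<n (ℕ.m∸n≤m n t)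
      flip : ∀ x y k → y ≡ x + k → - y + k ≡ - x
      flip x _ k refl = solve (x ∷ k ∷ [])
      after-before : ∀ {t} → t ℕ.< n → after p (kindAt (at (suc t))) ≡ before p (kindAt (at t))
      after-before {t} t<n = trans (sym (kindAt-link (at (suc t)))) (cong (λ z → before p (kindAt z)) (sym (at-suc t<n)))
      step : Potential value f n Φ
      step t t<n = negate _ _ _ (trans (level-step (kindAt (at t)))
        (cong (λ u → level u + value (f t)) (sym (after-before t<n))))
      distinct : Distinct (hmod n (4 ℕ.* p ℕ.+ 3)) f n Φ
      distinct t t′ t<t′ t′<n ft ft′ d =
        before-distinct (kindAt (at t′)) (kindAt (at t)) (valid-kindOf (reduce (at t′))) (valid-kindOf (reduce (at t))) gt′ gt
          (kindAt-distinct (ℕ.+-monoʳ-< j (ℕ.∸-monoʳ-< t<t′ (ℕ.<⇒≤ t′<n))) near (at<2n t<n) gt′ gt)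
          (subst (+ hmod n (4 ℕ.* p ℕ.+ 3) ∣_)
            (trans (cong₂ (λ u v → - level u - - level v) (after-before t<n) (after-before t′<n))
              (commute (level (before p (kindAt (at t)))) (level (before p (kindAt (at t′)))))) d)
        where
        t<n = ℕ.<-trans t<t′ t′<n
        gt  = filled⇒notGap (kindAt (at t)) ft
        gt′ = filled⇒notGap (kindAt (at t′)) ft′
        near : at t ℕ.< at t′ ℕ.+ n
        near = ℕ.≤-<-trans (ℕ.+-monoʳ-≤ j (ℕ.m∸n≤m n t))
          (ℕ.+-monoˡ-< n (ℕ.m<m+n j (ℕ.m<n⇒0<n∸m t′<n)))
        commute : ∀ x y → - x - - y ≡ y - x
        commute x y = solve (x ∷ y ∷ [])

  -- Linear forms

  -- form α β γ stands for α m + β u + γ.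
  record Form : Set where
    constructor form
    field
      α β γ : ℤ

  infixl 6 _⊞_ _⊟_

  _⊞_ _⊟_ : Form → Form → Form
  form α β γ ⊞ form α′ β′ γ′ = form (α + α′) (β + β′) (γ + γ′)
  form α β γ ⊟ form α′ β′ γ′ = form (α - α′) (β - β′) (γ - γ′)

  scale : ℤ → Form → Form
  scale t (form α β γ) = form (t * α) (t * β) (t * γ)

  -- Nonnegativity of a form for all m ≥ s + u, read off the substitution m = s + u + w.
  NonNegative : ℕ → Form → Set
  NonNegative s (form α β γ) = T (+ 0 ≤ᵇ (+ s * α + γ)) × T (+ 0 ≤ᵇ (α + β)) × T (+ 0 ≤ᵇ α)

  -- A certificate that `f` equals no natural multiple of `κ`, with a single quotient `t` good for
  -- all m and u of a class.
  data Avoids (s : ℕ) (κ f : Form) : Set where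
    negative : NonNegative s (form (+ 0) (+ 0) (- + 1) ⊟ f) → Avoids s κ f
    between  : ∀ t → NonNegative s (f ⊟ scale (+ t) κ ⊟ form (+ 0) (+ 0) (+ 1)) →
               NonNegative s (scale (+ suc t) κ ⊟ f ⊟ form (+ 0) (+ 0) (+ 1)) → Avoids s κ f

  one : Form
  one = form (+ 0) (+ 0) (+ 1)

  -- The inequalities of `Line` on coefficients. For concrete forms a true inequality computes to
  -- unit types, so Agda fills the field itself; only the sign of `a` has to be chosen.
  record FormChecks (s : ℕ) (κ b c : Form) : Set where
    a : Form
    a = form (+ 0) (+ 0) (+ 0) ⊟ (b ⊞ c)
    field
      K-low  : NonNegative s (κ ⊟ form (+ 4) (+ 0) (+ 1))
      K-high : NonNegative s (form (+ 8) (+ 0) (+ 1) ⊟ κ)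
      a-low  : NonNegative s (form (+ 5) (+ 0) (+ 0) ⊞ a)
      a-high : NonNegative s (form (+ 5) (+ 0) (+ 0) ⊟ a)
      b-low  : NonNegative s (form (+ 11) (+ 0) (+ 0) ⊞ b)
      b-high : NonNegative s (form (+ 12) (+ 0) (+ 0) ⊟ b)
      c-high : NonNegative s (form (+ 12) (+ 0) (+ 0) ⊟ c)
      a≢0    : NonNegative s (a ⊟ form (+ 0) (+ 0) (+ 1)) ⊎ NonNegative s (form (+ 0) (+ 0) (- + 1) ⊟ a)
      a<K    : NonNegative s (κ ⊟ a ⊟ one)
      -K<a   : NonNegative s ((κ ⊞ a) ⊟ one)

  module Evaluation (s u m : ℕ) (s+u≤m : s ℕ.+ u ℕ.≤ m) where

    eval : Form → ℤ
    eval (form α β γ) = α * + m + β * + u + γ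

    eval-⊞ : ∀ f g → eval (f ⊞ g) ≡ eval f + eval g
    eval-⊞ (form α β γ) (form α′ β′ γ′) = go (+ m) (+ u) α β γ α′ β′ γ′
      where
      go : ∀ M U α β γ α′ β′ γ′ →
           (α + α′) * M + (β + β′) * U + (γ + γ′) ≡ (α * M + β * U + γ) + (α′ * M + β′ * U + γ′)
      go M U α β γ α′ β′ γ′ = solve (M ∷ U ∷ α ∷ β ∷ γ ∷ α′ ∷ β′ ∷ γ′ ∷ [])

    eval-⊟ : ∀ f g → eval (f ⊟ g) ≡ eval f - eval g
    eval-⊟ (form α β γ) (form α′ β′ γ′) = go (+ m) (+ u) α β γ α′ β′ γ′
      where
      go : ∀ M U α β γ α′ β′ γ′ →
           (α - α′) * M + (β - β′) * U + (γ - γ′) ≡ (α * M + β * U + γ) - (α′ * M + β′ * U + γ′)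
      go M U α β γ α′ β′ γ′ = solve (M ∷ U ∷ α ∷ β ∷ γ ∷ α′ ∷ β′ ∷ γ′ ∷ [])

    eval-scale : ∀ t f → eval (scale t f) ≡ t * eval f
    eval-scale t (form α β γ) = go (+ m) (+ u) t α β γ
      where
      go : ∀ M U t α β γ → t * α * M + t * β * U + t * γ ≡ t * (α * M + β * U + γ)
      go M U t α β γ = solve (M ∷ U ∷ t ∷ α ∷ β ∷ γ ∷ [])

    eval-constant : ∀ γ → eval (form (+ 0) (+ 0) γ) ≡ γ
    eval-constant γ = go (+ m) (+ u) γ
      where
      go : ∀ M U γ → + 0 * M + + 0 * U + γ ≡ γ
      go M U γ = solve (M ∷ U ∷ γ ∷ [])

    eval-multiple : ∀ α → eval (form α (+ 0) (+ 0)) ≡ α * + m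
    eval-multiple α = go (+ m) (+ u) α
      where
      go : ∀ M U α → α * M + + 0 * U + + 0 ≡ α * M
      go M U α = solve (M ∷ U ∷ α ∷ [])

    eval-affine : ∀ α γ → eval (form α (+ 0) γ) ≡ α * + m + γ
    eval-affine α γ = go (+ m) (+ u) α γ
      where
      go : ∀ M U α γ → α * M + + 0 * U + γ ≡ α * M + γ
      go M U α γ = solve (M ∷ U ∷ α ∷ γ ∷ [])

    nonNegative : ∀ f → NonNegative s f → 0≤ eval f
    nonNegative (form α β γ) (p , q , r) =
      go (+ m) (+ u) (+ s) α β γ (ℤ.≤ᵇ⇒≤ p) (ℤ.≤ᵇ⇒≤ q) (ℤ.≤ᵇ⇒≤ r) (nat u) (cast-≤ s+u≤m)
      where
      go : ∀ M U S α β γ → 0≤ S * α + γ → 0≤ α + β → 0≤ α → 0≤ U → 0≤ M - (S + U) → + 0 Data.Integer.≤ α * M + β * U + γ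
      go M U S α β γ p q r 0≤U 0≤W = (p ⊕ q ⊗ 0≤U ⊕ r ⊗ 0≤W) ▸ solve (M ∷ U ∷ S ∷ α ∷ β ∷ γ ∷ [])

    nonNegative-+ : ∀ f g → NonNegative s (f ⊞ g) → 0≤ eval f + eval g
    nonNegative-+ f g h = nonNegative (f ⊞ g) h ▸ eval-⊞ f g

    nonNegative-- : ∀ f g → NonNegative s (f ⊟ g) → 0≤ eval f - eval g
    nonNegative-- f g h = nonNegative (f ⊟ g) h ▸ eval-⊟ f g

    nonNegative-<  : ∀ f g → NonNegative s (f ⊟ g ⊟ one) → 0≤ eval f - eval g - + 1
    nonNegative-< f g h = nonNegative (f ⊟ g ⊟ one) h ▸
      trans (eval-⊟ (f ⊟ g) one) (cong₂ _-_ (eval-⊟ f g) (eval-constant (+ 1)))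

    avoids : ∀ κ f → 0≤ eval κ → Avoids s κ f → ∀ t → eval f ≢ eval κ * + t
    avoids κ f 0≤K (negative h) t = go (eval f) (eval κ) (+ t) 0≤K (nat t)
      (nonNegative-- (form (+ 0) (+ 0) (- + 1)) f h ▸ cong (_- eval f) (eval-constant (- + 1)))
      where
      go : ∀ F K T → 0≤ K → 0≤ T → 0≤ - + 1 - F → F ≢ K * T
      go F K T 0≤K 0≤T h e = absurd 0 ((h ⊕ 0≤K ⊗ 0≤T ⊕ difference₁ e) ▸ solve (F ∷ K ∷ T ∷ []))
    avoids κ f 0≤K (between r h h′) t e with ℕ.<-≤-connex r t
    ... | inj₁ r<t = above (eval f) (eval κ) (+ t) (+ r) 0≤K (cast-< r<t)
            (nonNegative-< (scale (+ suc r) κ) f h′ ▸ cong (λ z → z - eval f - + 1) (eval-scale (+ suc r) κ)) e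
      where
      above : ∀ F K T R → 0≤ K → 0≤ T - (+ 1 + R) → 0≤ (+ 1 + R) * K - F - + 1 → F ≢ K * T
      above F K T R 0≤K R<T h e = absurd 0 ((h ⊕ 0≤K ⊗ R<T ⊕ difference₁ e) ▸ solve (F ∷ K ∷ T ∷ R ∷ []))
    ... | inj₂ t≤r = below (eval f) (eval κ) (+ t) (+ r) 0≤K (cast-≤ t≤r)
            (nonNegative-< f (scale (+ r) κ) h ▸ cong (λ z → eval f - z - + 1) (eval-scale (+ r) κ)) e
      where
      below : ∀ F K T R → 0≤ K → 0≤ R - T → 0≤ F - R * K - + 1 → F ≢ K * T
      below F K T R 0≤K T≤R h e = absurd 0 ((h ⊕ 0≤K ⊗ T≤R ⊕ difference₂ e) ▸ solve (F ∷ K ∷ T ∷ R ∷ []))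

    module _ {κ b c : Form} (checks : FormChecks s κ b c) where
      open FormChecks checks

      eval-a : eval a ≡ - (eval b + eval c)
      eval-a = trans (eval-⊟ (form (+ 0) (+ 0) (+ 0)) (b ⊞ c))
        (trans (cong₂ _-_ (eval-constant (+ 0)) (eval-⊞ b c)) (ℤ.+-identityˡ (- (eval b + eval c))))

      -- The conditions on multiples stay hypotheses because for column 0 they depend on `p`.
      formLine : ∀ p → (∀ t → t ℕ.≤ p → eval b ≢ - (eval κ * + t)) → (∀ t → t ℕ.≤ p → eval c ≢ eval κ * + t) →
                 (x y : ℕ → ℤ) → (∀ q → q ℕ.< p → InBlock (+ m) (+ q) (x q)) →
                 (∀ q → q ℕ.< p → InBlock (+ m) (+ q) (y q)) → Line m p
      formLine p b≢ c≢ x y x∈ y∈ = record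
        { K = eval κ ; a = - (eval b + eval c) ; b = eval b ; c = eval c ; x = x ; y = y
        ; K-low  = nonNegative-- κ (form (+ 4) (+ 0) (+ 1)) K-low ▸
            trans (cong (λ z → eval κ - z) (eval-affine (+ 4) (+ 1))) (split (eval κ) (+ m))
        ; K-high = nonNegative-- (form (+ 8) (+ 0) (+ 1)) κ K-high ▸ cong (_- eval κ) (eval-affine (+ 8) (+ 1))
        ; a+b+c  = cancel (eval b) (eval c)
        ; a-low  = nonNegative-+ (form (+ 5) (+ 0) (+ 0)) a a-low ▸ cong₂ _+_ (eval-multiple (+ 5)) eval-a
        ; a-high = nonNegative-- (form (+ 5) (+ 0) (+ 0)) a a-high ▸ cong₂ _-_ (eval-multiple (+ 5)) eval-a
        ; b-low  = nonNegative-+ (form (+ 11) (+ 0) (+ 0)) b b-low ▸ cong (_+ eval b) (eval-multiple (+ 11))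
        ; b-high = nonNegative-- (form (+ 12) (+ 0) (+ 0)) b b-high ▸ cong (_- eval b) (eval-multiple (+ 12))
        ; c-high = nonNegative-- (form (+ 12) (+ 0) (+ 0)) c c-high ▸ cong (_- eval c) (eval-multiple (+ 12))
        ; a≢0    = nonzero a≢0
        ; a<K    = nonNegative-< κ a a<K ▸ cong (λ z → eval κ - z - + 1) eval-a
        ; -K<a   = nonNegative-- (κ ⊞ a) one -K<a ▸
            cong₂ _-_ (trans (eval-⊞ κ a) (cong (λ z → eval κ + z) eval-a)) (eval-constant (+ 1))
        ; b≢ = b≢ ; c≢ = c≢ ; x∈ = x∈ ; y∈ = y∈
        }
        where
        split : ∀ K M → K - (+ 4 * M + + 1) ≡ K - + 4 * M - + 1
        split K M = solve (K ∷ M ∷ [])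
        cancel : ∀ b c → - (b + c) + b + c ≡ + 0
        cancel b c = solve (b ∷ c ∷ [])
        nonzero : NonNegative s (a ⊟ form (+ 0) (+ 0) (+ 1)) ⊎ NonNegative s (form (+ 0) (+ 0) (- + 1) ⊟ a) →
                  - (eval b + eval c) ≢ + 0
        nonzero (inj₁ h) e = absurd 0 (nonNegative-- a one h ▸ cong₂ _-_ (trans eval-a e) (eval-constant (+ 1)))
        nonzero (inj₂ h) e = absurd 0 (nonNegative-- (form (+ 0) (+ 0) (- + 1)) a h ▸
          cong₂ _-_ (eval-constant (- + 1)) (trans eval-a e))

  -- The three inner diagonals

  -- Columns by parity and by half, lower or upper. Column 0 stands apart because its `b` breaks the
  -- pattern of `even₀`.
  data Shape : Set where
    origin even₀ even₁ odd₀ odd₁ : Shape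

  infix 5 _at_

  record Class : Set where
    constructor _at_
    field
      shape : Shape
      coord : ℕ

  -- The least value of m - u. `even₀` has one column fewer than the other halves, column 0 being
  -- `origin`.
  slack : Shape → ℕ
  slack even₀ = 2
  slack _     = 1

  -- The values in the cells (j - 2m - 1, j) and (j - 2m + 1, j) of column j; the diagonal entry is - (b + c).
  bForm cForm : Shape → Form
  bForm origin = form (- + 9) (+ 0) (- + 1)
  bForm even₀  = form (- + 11) (+ 1) (+ 0)
  bForm even₁  = form (- + 10) (+ 1) (- + 1)
  bForm odd₀   = form (+ 2) (+ 1) (+ 1)
  bForm odd₁   = form (+ 8) (+ 1) (+ 1)
  cForm origin = form (+ 11) (+ 0) (+ 1)
  cForm even₀  = form (+ 11) (+ 1) (+ 2)
  cForm even₁  = form (+ 5) (+ 1) (+ 1)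
  cForm odd₀   = form (- + 7) (+ 1) (+ 0)
  cForm odd₁   = form (- + 8) (+ 1) (+ 0)

  columnNet : Shape → Form
  columnNet origin = form (+ 4) (+ 0) (+ 1)
  columnNet _      = form (+ 8) (+ 0) (+ 1)

  rowNet 3m : Form
  rowNet = form (+ 8) (+ 0) (+ 0)
  3m     = form (+ 3) (+ 0) (+ 0)

  neg : Form → Form
  neg f = form (+ 0) (+ 0) (+ 0) ⊟ f

  module Lines (μ p : ℕ) (p≤μ : p ℕ.≤ μ) where
    open Offsets μ p p≤μ

    Member : Class → Set
    Member (origin at u) = u ≡ 0
    Member (f at u)      = slack f ℕ.+ u ℕ.≤ m

    index : Class → ℕ
    index (origin at _) = 0
    index (even₀ at u)  = 2 ℕ.* suc u
    index (even₁ at u)  = 2 ℕ.* u ℕ.+ 2 ℕ.* m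
    index (odd₀ at u)   = 1 ℕ.+ 2 ℕ.* u
    index (odd₁ at u)   = 1 ℕ.+ 2 ℕ.* u ℕ.+ 2 ℕ.* m

    private
      lower upper : Parity → Class
      lower (even zero)    = origin at 0
      lower (even (suc u)) = even₀ at u
      lower (odd u)        = odd₀ at u
      upper (even u)       = even₁ at u
      upper (odd u)        = odd₁ at u

      double : ∀ {u} → suc u ℕ.≤ m → suc (1 ℕ.+ 2 ℕ.* u) ℕ.≤ 2 ℕ.* m
      double {u} u<m = ℕ.≤-trans (ℕ.≤-reflexive (sym (ℕ.*-suc 2 u))) (ℕ.*-monoʳ-≤ 2 u<m)

      n≡2m+2m : n ≡ 2 ℕ.* m ℕ.+ 2 ℕ.* m
      n≡2m+2m = go m
        where
        go : ∀ m → 4 ℕ.* m ≡ 2 ℕ.* m ℕ.+ 2 ℕ.* m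
        go m = ℕ-Solver.solve (m ∷ [])

    classify : ℕ → Class
    classify j with j ℕ.<? 2 ℕ.* m
    ... | yes _ = lower (parity j)
    ... | no _  = upper (parity (j ℕ.∸ 2 ℕ.* m))

    member-slack : ∀ k → Member k → slack (Class.shape k) ℕ.+ Class.coord k ℕ.≤ m
    member-slack (origin at _) refl = s≤s z≤n
    member-slack (even₀ at _) h = h
    member-slack (even₁ at _) h = h
    member-slack (odd₀ at _) h  = h
    member-slack (odd₁ at _) h  = h

    classify-index : ∀ k → Member k → classify (index k) ≡ k
    classify-index (origin at _) refl = refl
    classify-index (even₀ at u) h with 2 ℕ.* suc u ℕ.<? 2 ℕ.* m
    ... | yes _ = cong lower (parity-even (suc u))
    ... | no ¬< = contradiction (ℕ.*-monoʳ-< 2 h) ¬<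
    classify-index (even₁ at u) h with 2 ℕ.* u ℕ.+ 2 ℕ.* m ℕ.<? 2 ℕ.* m
    ... | yes l = contradiction l (ℕ.≤⇒≯ (ℕ.m≤n+m (2 ℕ.* m) (2 ℕ.* u)))
    ... | no _  = cong upper (trans (cong parity (ℕ.m+n∸n≡m (2 ℕ.* u) (2 ℕ.* m))) (parity-even u))
    classify-index (odd₀ at u) h with 1 ℕ.+ 2 ℕ.* u ℕ.<? 2 ℕ.* m
    ... | yes _ = cong lower (parity-odd u)
    ... | no ¬< = contradiction (double h) ¬<
    classify-index (odd₁ at u) h with 1 ℕ.+ 2 ℕ.* u ℕ.+ 2 ℕ.* m ℕ.<? 2 ℕ.* m
    ... | yes l = contradiction l (ℕ.≤⇒≯ (ℕ.m≤n+m (2 ℕ.* m) (1 ℕ.+ 2 ℕ.* u)))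
    ... | no _  = cong upper (trans (cong parity (ℕ.m+n∸n≡m (1 ℕ.+ 2 ℕ.* u) (2 ℕ.* m))) (parity-odd u))

    private
      lower-index : ∀ π → index (lower π) ≡ fromParity π
      lower-index (even zero)    = refl
      lower-index (even (suc _)) = refl
      lower-index (odd _)        = refl

      upper-index : ∀ π → index (upper π) ≡ fromParity π ℕ.+ 2 ℕ.* m
      upper-index (even _) = refl
      upper-index (odd _)  = refl

      lower-member : ∀ π → fromParity π ℕ.< 2 ℕ.* m → Member (lower π)
      lower-member (even zero) _    = refl
      lower-member (even (suc u)) l = ℕ.*-cancelˡ-< 2 (suc u) m l
      lower-member (odd u) l        = ℕ.*-cancelˡ-< 2 u m (ℕ.<⇒≤ l)

      upper-member : ∀ π → fromParity π ℕ.< 2 ℕ.* m → Member (upper π)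
      upper-member (even u) l = ℕ.*-cancelˡ-< 2 u m l
      upper-member (odd u) l  = ℕ.*-cancelˡ-< 2 u m (ℕ.<⇒≤ l)

    index-classify : ∀ j → index (classify j) ≡ j
    index-classify j with j ℕ.<? 2 ℕ.* m
    ... | yes _ = trans (lower-index (parity j)) (fromParity-parity j)
    ... | no ¬< = trans (upper-index (parity (j ℕ.∸ 2 ℕ.* m)))
            (trans (cong (ℕ._+ 2 ℕ.* m) (fromParity-parity (j ℕ.∸ 2 ℕ.* m))) (ℕ.m∸n+n≡m (ℕ.≮⇒≥ ¬<)))

    classify-member : ∀ j → j ℕ.< n → Member (classify j)
    classify-member j j<n with j ℕ.<? 2 ℕ.* m
    ... | yes l = lower-member (parity j) (subst (ℕ._< 2 ℕ.* m) (sym (fromParity-parity j)) l)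
    ... | no ¬l = upper-member (parity (j ℕ.∸ 2 ℕ.* m))
            (subst (ℕ._< 2 ℕ.* m) (sym (fromParity-parity (j ℕ.∸ 2 ℕ.* m)))
              (ℕ.+-cancelʳ-< (2 ℕ.* m) _ _ (subst (ℕ._< 2 ℕ.* m ℕ.+ 2 ℕ.* m) (sym (ℕ.m∸n+n≡m (ℕ.≮⇒≥ ¬l)))
                (subst (j ℕ.<_) n≡2m+2m j<n))))

    index<n : ∀ k → Member k → index k ℕ.< n
    index<n k h = subst (index k ℕ.<_) (sym n≡2m+2m) (bound k h)
      where
      bound : ∀ k → Member k → index k ℕ.< 2 ℕ.* m ℕ.+ 2 ℕ.* m
      bound (origin at _) _ = s≤s z≤n
      bound (even₀ at u) h  = ℕ.≤-trans (ℕ.*-monoʳ-< 2 h) (ℕ.m≤m+n _ _)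
      bound (even₁ at u) h  = ℕ.+-monoˡ-< (2 ℕ.* m) (ℕ.*-monoʳ-< 2 h)
      bound (odd₀ at u) h   = ℕ.≤-trans (double h) (ℕ.m≤m+n _ _)
      bound (odd₁ at u) h   = ℕ.+-monoˡ-< (2 ℕ.* m) (double h)

    -- The expression of `eval` without the bound on `u`; the two agree by computation.
    valueAt : (Shape → Form) → Class → ℤ
    valueAt F (f at u) = Form.α (F f) * + m + Form.β (F f) * + u + Form.γ (F f)

    private
      -- The class of column j + 2m - 1 mod n, in which row j has its `c-cell`.
      shift : Class → Class
      shift (origin at _)     = odd₀ at μ
      shift (even₀ at u)      = odd₁ at u
      shift (even₁ at zero)   = odd₁ at μ
      shift (even₁ at suc u)  = odd₀ at u
      shift (odd₀ at u)       = even₁ at u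
      shift (odd₁ at zero)    = origin at 0
      shift (odd₁ at suc u)   = even₀ at u

      shift-member : ∀ k → Member k → Member (shift k)
      shift-member (origin at _) _    = ℕ.≤-refl
      shift-member (even₀ at u) h     = ℕ.<⇒≤ h
      shift-member (even₁ at zero) _  = ℕ.≤-refl
      shift-member (even₁ at suc u) h = ℕ.<⇒≤ h
      shift-member (odd₀ at u) h      = h
      shift-member (odd₁ at zero) _   = refl
      shift-member (odd₁ at suc u) h  = h

      shift-index : ∀ k → Member k → reduce (index k ℕ.+ suc (2 ℕ.* μ)) ≡ index (shift k)
      shift-index k h = go k h (shift-sum k)
        where
        shift-sum : ∀ k → index k ℕ.+ suc (2 ℕ.* μ) ≡ index (shift k) ⊎ index k ℕ.+ suc (2 ℕ.* μ) ≡ n ℕ.+ index (shift k)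
        shift-sum (origin at _) = inj₁ refl
        shift-sum (even₀ at u)  = inj₁ (ring u μ)
          where
          ring : ∀ u μ → 2 ℕ.* suc u ℕ.+ suc (2 ℕ.* μ) ≡ 1 ℕ.+ 2 ℕ.* u ℕ.+ 2 ℕ.* suc μ
          ring u μ = ℕ-Solver.solve (u ∷ μ ∷ [])
        shift-sum (even₁ at zero) = inj₁ (ring μ)
          where
          ring : ∀ μ → 2 ℕ.* 0 ℕ.+ 2 ℕ.* suc μ ℕ.+ suc (2 ℕ.* μ) ≡ 1 ℕ.+ 2 ℕ.* μ ℕ.+ 2 ℕ.* suc μ
          ring μ = ℕ-Solver.solve (μ ∷ [])
        shift-sum (even₁ at suc u) = inj₂ (ring u μ)
          where
          ring : ∀ u μ → 2 ℕ.* suc u ℕ.+ 2 ℕ.* suc μ ℕ.+ suc (2 ℕ.* μ) ≡ 4 ℕ.* suc μ ℕ.+ (1 ℕ.+ 2 ℕ.* u)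
          ring u μ = ℕ-Solver.solve (u ∷ μ ∷ [])
        shift-sum (odd₀ at u) = inj₁ (ring u μ)
          where
          ring : ∀ u μ → 1 ℕ.+ 2 ℕ.* u ℕ.+ suc (2 ℕ.* μ) ≡ 2 ℕ.* u ℕ.+ 2 ℕ.* suc μ
          ring u μ = ℕ-Solver.solve (u ∷ μ ∷ [])
        shift-sum (odd₁ at zero) = inj₂ (ring μ)
          where
          ring : ∀ μ → 1 ℕ.+ 2 ℕ.* 0 ℕ.+ 2 ℕ.* suc μ ℕ.+ suc (2 ℕ.* μ) ≡ 4 ℕ.* suc μ ℕ.+ 0
          ring μ = ℕ-Solver.solve (μ ∷ [])
        shift-sum (odd₁ at suc u) = inj₂ (ring u μ)
          where
          ring : ∀ u μ → 1 ℕ.+ 2 ℕ.* suc u ℕ.+ 2 ℕ.* suc μ ℕ.+ suc (2 ℕ.* μ) ≡ 4 ℕ.* suc μ ℕ.+ 2 ℕ.* suc u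
          ring u μ = ℕ-Solver.solve (u ∷ μ ∷ [])
        go : ∀ k → Member k → (index k ℕ.+ suc (2 ℕ.* μ) ≡ index (shift k) ⊎ index k ℕ.+ suc (2 ℕ.* μ) ≡ n ℕ.+ index (shift k)) →
             reduce (index k ℕ.+ suc (2 ℕ.* μ)) ≡ index (shift k)
        go k h (inj₁ e) = trans (cong reduce e) (reduce-< (index<n (shift k) (shift-member k h)))
        go k h (inj₂ e) = trans (cong reduce e) (reduce-≥ (index (shift k)))

      shift-value : ∀ k → Member k → valueAt cForm (shift k) ≡ valueAt bForm k + + 3 * + m
      shift-value (origin at _) refl = ring (+ μ)
        where
        ring : ∀ μ → - + 7 * (+ 1 + μ) + + 1 * μ + + 0 ≡ - + 9 * (+ 1 + μ) + + 0 * + 0 + - + 1 + + 3 * (+ 1 + μ)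
        ring μ = solve (μ ∷ [])
      shift-value (even₀ at u) _ = ring (+ m) (+ u)
        where
        ring : ∀ M U → - + 8 * M + + 1 * U + + 0 ≡ - + 11 * M + + 1 * U + + 0 + + 3 * M
        ring M U = solve (M ∷ U ∷ [])
      shift-value (even₁ at zero) _ = ring (+ μ)
        where
        ring : ∀ μ → - + 8 * (+ 1 + μ) + + 1 * μ + + 0 ≡ - + 10 * (+ 1 + μ) + + 1 * + 0 + - + 1 + + 3 * (+ 1 + μ)
        ring μ = solve (μ ∷ [])
      shift-value (even₁ at suc u) _ = ring (+ m) (+ u)
        where
        ring : ∀ M U → - + 7 * M + + 1 * U + + 0 ≡ - + 10 * M + + 1 * (+ 1 + U) + - + 1 + + 3 * M
        ring M U = solve (M ∷ U ∷ [])
      shift-value (odd₀ at u) _ = ring (+ m) (+ u)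
        where
        ring : ∀ M U → + 5 * M + + 1 * U + + 1 ≡ + 2 * M + + 1 * U + + 1 + + 3 * M
        ring M U = solve (M ∷ U ∷ [])
      shift-value (odd₁ at zero) _ = ring (+ m)
        where
        ring : ∀ M → + 11 * M + + 0 * + 0 + + 1 ≡ + 8 * M + + 1 * + 0 + + 1 + + 3 * M
        ring M = solve (M ∷ [])
      shift-value (odd₁ at suc u) _ = ring (+ m) (+ u)
        where
        ring : ∀ M U → + 11 * M + + 1 * U + + 2 ≡ + 8 * M + + 1 * (+ 1 + U) + + 1 + + 3 * M
        ring M U = solve (M ∷ U ∷ [])

    B C : ℕ → ℤ
    B j = valueAt bForm (classify j)
    C j = valueAt cForm (classify j)

    -- A row uses this twice: forwards for its `c-cell` and, through `opposite`, backwards for its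
    -- `b-cell`.
    neighbour : ∀ i j → i ℕ.< n → reduce (i ℕ.+ suc (2 ℕ.* μ)) ≡ j → C j ≡ B i + + 3 * + m
    neighbour i j i<n e = trans (cong (valueAt cForm) class) (shift-value k h)
      where
      k = classify i
      h = classify-member i i<n
      class : classify j ≡ shift k
      class = trans (cong classify (trans (sym e) (trans (cong (λ z → reduce (z ℕ.+ suc (2 ℕ.* μ))) (sym (index-classify i)))
                (shift-index k h)))) (classify-index (shift k) (shift-member k h))

  -- Agreement of the row and column descriptions

  private
    columnChecks : ∀ f → FormChecks (slack f) (columnNet f) (bForm f) (cForm f)
    columnChecks origin = record { a≢0 = inj₂ _ }
    columnChecks even₀  = record { a≢0 = inj₂ _ }
    columnChecks even₁  = record { a≢0 = inj₁ _ }
    columnChecks odd₀   = record { a≢0 = inj₁ _ }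
    columnChecks odd₁   = record { a≢0 = inj₂ _ }

    -- Row i is described by the class of column i: up to 3m the two forms exchange their roles.
    rowChecks : ∀ f → FormChecks (slack f) rowNet (cForm f ⊟ 3m) (bForm f ⊞ 3m)
    rowChecks origin = record { a≢0 = inj₂ _ }
    rowChecks even₀  = record { a≢0 = inj₂ _ }
    rowChecks even₁  = record { a≢0 = inj₁ _ }
    rowChecks odd₀   = record { a≢0 = inj₁ _ }
    rowChecks odd₁   = record { a≢0 = inj₂ _ }

    column-c : ∀ f → Avoids (slack f) (columnNet f) (cForm f)
    column-c origin = between 2 _ _
    column-c even₀  = between 1 _ _
    column-c even₁  = between 0 _ _
    column-c odd₀   = negative _
    column-c odd₁   = negative _

    -- At the origin with m = 1 the entry b = - 10 is a multiple of the net 5; there p = 0.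
    column-b : ∀ f → f ≢ origin → Avoids (slack f) (columnNet f) (neg (bForm f))
    column-b origin f≢ = contradiction refl f≢
    column-b even₀ _   = between 1 _ _
    column-b even₁ _   = between 1 _ _
    column-b odd₀ _    = negative _
    column-b odd₁ _    = negative _

    -- Slack 2 expresses m ≥ 2, and then 9m + 1 lies strictly between 2 (4m + 1) and 3 (4m + 1).
    origin-b : Avoids 2 (columnNet origin) (neg (bForm origin))
    origin-b = between 2 _ _

    row-c : ∀ f → Avoids (slack f) rowNet (bForm f ⊞ 3m)
    row-c origin = negative _
    row-c even₀  = negative _
    row-c even₁  = negative _
    row-c odd₀   = between 0 _ _
    row-c odd₁   = between 1 _ _

    row-b : ∀ f → Avoids (slack f) rowNet (neg (cForm f ⊟ 3m))
    row-b origin = negative _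
    row-b even₀  = negative _
    row-b even₁  = negative _
    row-b odd₀   = between 1 _ _
    row-b odd₁   = between 1 _ _

  module Rows-and-columns (μ p : ℕ) (p≤μ : p ℕ.≤ μ) where
    open Offsets μ p p≤μ
    open Lines μ p p≤μ

    blockValue : ℕ → ℕ → ℤ
    blockValue q j = + 16 * + m * (+ q + + 1) - + j

    private
      blockValue-in : ∀ q j → j ℕ.< n → InBlock (+ m) (+ q) (blockValue q j)
      blockValue-in q j j<n = record
        { above = (cast-< j<n ▸ cong (_- (+ 1 + + j)) (ℤ.pos-* 4 m)) ▸ lower (+ m) (+ q) (+ j)
        ; below = nat j ▸ upper (+ m) (+ q) (+ j)
        }
        where
        lower : ∀ M Q J → + 4 * M - (+ 1 + J) ≡ + 16 * M * (Q + + 1) - J - (+ 16 * M * Q + + 12 * M + + 1)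
        lower M Q J = solve (M ∷ Q ∷ J ∷ [])
        upper : ∀ M Q J → J ≡ + 16 * M * (Q + + 1) - (+ 16 * M * (Q + + 1) - J)
        upper M Q J = solve (M ∷ Q ∷ J ∷ [])


    private
      avoids-neg : ∀ s u (h : s ℕ.+ u ℕ.≤ m) κ b → let open Evaluation s u m h in
                   0≤ eval κ → Avoids s κ (neg b) → ∀ t → eval b ≢ - (eval κ * + t)
      avoids-neg s u h κ b 0≤K av t e = E.avoids κ (neg b) 0≤K av t
        (trans (trans (E.eval-⊟ (form (+ 0) (+ 0) (+ 0)) b)
            (trans (cong (_- E.eval b) (E.eval-constant (+ 0))) (ℤ.+-identityˡ (- E.eval b))))
          (trans (cong -_ e) (ℤ.neg-involutive _)))
        where
        module E = Evaluation s u m h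

      columnNet-nonNegative : ∀ f → NonNegative (slack f) (columnNet f)
      columnNet-nonNegative origin = _
      columnNet-nonNegative even₀  = _
      columnNet-nonNegative even₁  = _
      columnNet-nonNegative odd₀   = _
      columnNet-nonNegative odd₁   = _

      rowNet-nonNegative : ∀ f → NonNegative (slack f) rowNet
      rowNet-nonNegative origin = _
      rowNet-nonNegative even₀  = _
      rowNet-nonNegative even₁  = _
      rowNet-nonNegative odd₀   = _
      rowNet-nonNegative odd₁   = _

      -- For t = 0 it suffices that b is negative; a positive t ≤ p ≤ μ forces m ≥ 2, where
      -- `origin-b` applies.
      origin-b≢ : ∀ t → t ℕ.≤ p → valueAt bForm (origin at 0) ≢ - (valueAt columnNet (origin at 0) * + t)
      origin-b≢ zero _ e = ring (+ m) (nat m) e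
        where
        ring : ∀ M → 0≤ M → - + 9 * M + + 0 * + 0 + - + 1 ≢ - ((+ 4 * M + + 0 * + 0 + + 1) * + 0)
        ring M 0≤M e = absurd 0 ((nat 9 ⊗ 0≤M ⊕ difference₁ e) ▸ solve (M ∷ []))
      origin-b≢ (suc t) t<p = avoids-neg 2 0 2≤m (columnNet origin) (bForm origin)
        (Evaluation.nonNegative 2 0 m 2≤m (columnNet origin) _) origin-b (suc t)
        where
        2≤m : 2 ℕ.+ 0 ℕ.≤ m
        2≤m = s≤s (ℕ.≤-trans (s≤s z≤n) (ℕ.≤-trans t<p p≤μ))

      column-b≢ : ∀ k (h : Member k) t → t ℕ.≤ p → valueAt bForm k ≢ - (valueAt columnNet k * + t)
      column-b≢ (origin at u) refl = origin-b≢
      column-b≢ (even₀ at u) h t _ = avoids-neg 2 u h (columnNet even₀) (bForm even₀)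
        (Evaluation.nonNegative 2 u m h (columnNet even₀) _) (column-b even₀ λ ()) t
      column-b≢ (even₁ at u) h t _ = avoids-neg 1 u h (columnNet even₁) (bForm even₁)
        (Evaluation.nonNegative 1 u m h (columnNet even₁) _) (column-b even₁ λ ()) t
      column-b≢ (odd₀ at u) h t _  = avoids-neg 1 u h (columnNet odd₀) (bForm odd₀)
        (Evaluation.nonNegative 1 u m h (columnNet odd₀) _) (column-b odd₀ λ ()) t
      column-b≢ (odd₁ at u) h t _  = avoids-neg 1 u h (columnNet odd₁) (bForm odd₁)
        (Evaluation.nonNegative 1 u m h (columnNet odd₁) _) (column-b odd₁ λ ()) t

    column : ∀ j → j ℕ.< n → Line m p
    column j j<n = E.formLine (columnChecks f) p (column-b≢ k h)
      (λ t _ → E.avoids (columnNet f) (cForm f) (E.nonNegative (columnNet f) (columnNet-nonNegative f)) (column-c f) t)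
      (λ q → blockValue q j) (λ q → blockValue q j)
      (λ q _ → blockValue-in q j j<n) (λ q _ → blockValue-in q j j<n)
      where
      k = classify j
      f = Class.shape k
      h = classify-member j j<n
      module E = Evaluation (slack f) (Class.coord k) m (member-slack k h)

    -- Block values depend on the column, so `x` and `y` are read in the column where each opening
    -- offset lands.
    row : ∀ i → i ℕ.< n → Line m p
    row i i<n = E.formLine (rowChecks f) p
      (λ t _ → avoids-neg (slack f) (Class.coord k) (member-slack k h) rowNet (cForm f ⊟ 3m) 0≤net (row-b f) t)
      (λ t _ → E.avoids rowNet (bForm f ⊞ 3m) 0≤net (row-c f) t)
      (λ q → blockValue q (reduce (i ℕ.+ offsetOf (x-open q))))
      (λ q → blockValue q (reduce (i ℕ.+ offsetOf (y-open q))))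
      (λ q q<p → blockValue-in q _ (reduce<n (ℕ.+-mono-< i<n (offsetOf<n (x-open q) q<p))))
      (λ q q<p → blockValue-in q _ (reduce<n (ℕ.+-mono-< i<n (offsetOf<n (y-open q) q<p))))
      where
      k = classify i
      f = Class.shape k
      h = classify-member i i<n
      module E = Evaluation (slack f) (Class.coord k) m (member-slack k h)
      0≤net = E.nonNegative rowNet (rowNet-nonNegative f)

    net : ℕ → ℤ
    net zero    = + 4 * + m + + 1
    net (suc _) = + 8 * + m + + 1

    column-net : ∀ j → valueAt columnNet (classify j) ≡ net j
    column-net j = trans (go (classify j)) (cong net (index-classify j))
      where
      constant : ∀ α u → α * + m + + 0 * + u + + 1 ≡ α * + m + + 1
      constant α u = ring (+ m) α (+ u)
        where
        ring : ∀ M α U → α * M + + 0 * U + + 1 ≡ α * M + + 1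
        ring M α U = solve (M ∷ α ∷ U ∷ [])
      go : ∀ k → valueAt columnNet k ≡ net (index k)
      go (origin at u) = constant (+ 4) u
      go (even₀ at u)  = constant (+ 8) u
      go (even₁ at u)  = trans (constant (+ 8) u) (cong net (sym (ℕ.+-suc (2 ℕ.* u) _)))
      go (odd₀ at u)   = constant (+ 8) u
      go (odd₁ at u)   = constant (+ 8) u

    private
      reduce-suc : ∀ x → x ℕ.< n ℕ.+ n → reduce (suc x) ≡ suc (reduce x) ⊎ (reduce (suc x) ≡ 0 × suc (reduce x) ≡ n)
      reduce-suc x x<2n with ℕ.<-cmp (suc x) n
      ... | tri< 1+x<n _ _ = inj₁ (trans (reduce-< 1+x<n) (cong suc (sym (reduce-< (ℕ.<⇒≤ 1+x<n)))))
      ... | tri≈ _ 1+x≡n _ = inj₂ (trans (cong reduce (trans 1+x≡n (sym (ℕ.+-identityʳ n)))) (reduce-≥ 0) ,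
              trans (cong suc (reduce-< (ℕ.≤-reflexive 1+x≡n))) 1+x≡n)
      ... | tri> _ _ (s≤s n≤x) = inj₁ (subst (λ z → reduce (suc z) ≡ suc (reduce z)) (ℕ.m+[n∸m]≡n n≤x)
              (trans (cong reduce (sym (ℕ.+-suc n (x ℕ.∸ n)))) (trans (reduce-≥ (suc (x ℕ.∸ n))) (cong suc (sym (reduce-≥ (x ℕ.∸ n)))))))

      -- A row pair closes one column after it opens. The closing entry is computed from the opening
      -- column with net 8m and from its own column with `net`; both give the same size. The second
      -- case is the wrap to column 0.
      closing : ∀ q x j → x ℕ.< n ℕ.+ n → reduce (suc x) ≡ j →
                + 8 * + m + blockValue q (reduce x) ≡ net j + blockValue q j
      closing q x j x<2n refl with reduce-suc x x<2n
      ... | inj₁ e rewrite e = ring (+ m) (+ q) (+ reduce x)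
        where
        ring : ∀ M Q R → + 8 * M + (+ 16 * M * (Q + + 1) - R) ≡ + 8 * M + + 1 + (+ 16 * M * (Q + + 1) - (+ 1 + R))
        ring M Q R = solve (M ∷ Q ∷ R ∷ [])
      ... | inj₂ (e , e′) rewrite e = ring (+ m) (+ q) (+ reduce x) (trans (cong +_ e′) (ℤ.pos-* 4 m))
        where
        ring : ∀ M Q R → + 1 + R ≡ + 4 * M →
               + 8 * M + (+ 16 * M * (Q + + 1) - R) ≡ + 4 * M + + 1 + (+ 16 * M * (Q + + 1) - + 0)
        ring M Q R e = trans {j = + 8 * M + + 16 * M * (Q + + 1) + + 1 - (+ 1 + R)} (solve (M ∷ Q ∷ R ∷ []))
          (trans (cong (λ z → + 8 * M + + 16 * M * (Q + + 1) + + 1 - z) e) (solve (M ∷ Q ∷ [])))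

      row-K : ∀ i (i<n : i ℕ.< n) → Line.K (row i i<n) ≡ + 8 * + m
      row-K i i<n = ring (+ m) (+ Class.coord (classify i))
        where
        ring : ∀ M U → + 8 * M + + 0 * U + + 0 ≡ + 8 * M
        ring M U = solve (M ∷ U ∷ [])

      row-b-value : ∀ i (i<n : i ℕ.< n) → Line.b (row i i<n) ≡ C i - + 3 * + m
      row-b-value i i<n = trans (E.eval-⊟ (cForm f) 3m) (cong (λ z → C i - z) (E.eval-multiple (+ 3)))
        where
        k = classify i
        f = Class.shape k
        module E = Evaluation (slack f) (Class.coord k) m (member-slack k (classify-member i i<n))

      row-c-value : ∀ i (i<n : i ℕ.< n) → Line.c (row i i<n) ≡ B i + + 3 * + m
      row-c-value i i<n = trans (E.eval-⊞ (bForm f) 3m) (cong (λ z → B i + z) (E.eval-multiple (+ 3)))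
        where
        k = classify i
        f = Class.shape k
        module E = Evaluation (slack f) (Class.coord k) m (member-slack k (classify-member i i<n))

      -- The offsets 2m + 1 and 2m - 1 add up to n.
      opposite : ∀ i j → i ℕ.< n → reduce (i ℕ.+ offsetOf b-cell) ≡ j → reduce (j ℕ.+ suc (2 ℕ.* μ)) ≡ i
      opposite i j i<n refl with i ℕ.+ offsetOf b-cell ℕ.<? n
      ... | yes _ = trans (cong reduce (ring i μ)) (reduce-≥ i)
        where
        ring : ∀ i μ → i ℕ.+ suc (2 ℕ.+ 2 ℕ.* μ) ℕ.+ suc (2 ℕ.* μ) ≡ 4 ℕ.* suc μ ℕ.+ i
        ring i μ = ℕ-Solver.solve (i ∷ μ ∷ [])
      ... | no ¬< = trans (cong reduce (ℕ.+-cancelʳ-≡ n _ _ (trans (swap (i ℕ.+ offsetOf b-cell ℕ.∸ n) μ)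
                      (trans (cong (ℕ._+ suc (2 ℕ.* μ)) (ℕ.m∸n+n≡m (ℕ.≮⇒≥ ¬<))) (ring i μ))))) (reduce-< i<n)
        where
        swap : ∀ x μ → x ℕ.+ suc (2 ℕ.* μ) ℕ.+ 4 ℕ.* suc μ ≡ x ℕ.+ 4 ℕ.* suc μ ℕ.+ suc (2 ℕ.* μ)
        swap x μ = ℕ-Solver.solve (x ∷ μ ∷ [])
        ring : ∀ i μ → i ℕ.+ suc (2 ℕ.+ 2 ℕ.* μ) ℕ.+ suc (2 ℕ.* μ) ≡ i ℕ.+ 4 ℕ.* suc μ
        ring i μ = ℕ-Solver.solve (i ∷ μ ∷ [])

    -- The array is defined by columns; this transports it to the row description, on which the
    -- ascending walk runs.
    agree : ∀ i j (i<n : i ℕ.< n) (j<n : j ℕ.< n) k → Valid p k → (NotGap k → reduce (i ℕ.+ offsetOf k) ≡ j) →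
            LineProperties.content (s≤s z≤n) (row i i<n) k ≡ LineProperties.content (s≤s z≤n) (column j j<n) k
    agree i j i<n j<n a-cell _ h with trans (sym (trans (cong reduce (ℕ.+-identityʳ i)) (reduce-< i<n))) (h tt)
    ... | refl = cong just (trans (cong -_ (cong₂ _+_ (row-b-value i i<n) (row-c-value i i<n))) (ring (+ m) (B i) (C i)))
      where
      ring : ∀ M B C → - (C - + 3 * M + (B + + 3 * M)) ≡ - (B + C)
      ring M B C = solve (M ∷ B ∷ C ∷ [])
    agree i j i<n j<n b-cell _ h = cong just (trans (row-b-value i i<n)
      (trans (cong (_- + 3 * + m) (neighbour j i j<n (opposite i j i<n (h tt)))) (ring (+ m) (B j))))
      where
      ring : ∀ M B → B + + 3 * M - + 3 * M ≡ B
      ring M B = solve (M ∷ B ∷ [])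
    agree i j i<n j<n c-cell _ h = cong just (trans (row-c-value i i<n) (sym (neighbour i j i<n (h tt))))
    agree i j i<n j<n gap₁ _ _ = refl
    agree i j i<n j<n gap₂ _ _ = refl
    agree i j i<n j<n gap₃ _ _ = refl
    agree i j i<n j<n (x-open q) _ h = cong (λ z → just (blockValue q z)) (h tt)
    agree i j i<n j<n (y-open q) _ h = cong (λ z → just (- (blockValue q z + + 4 * + m))) (h tt)
    agree i j i<n j<n (x-close q) v h = cong just (go (Line.K (row i i<n)) (Line.K (column j j<n)) (blockValue q (reduce (i ℕ.+ offsetOf (x-open q)))) (blockValue q j)
      (trans (cong (_+ blockValue q (reduce (i ℕ.+ offsetOf (x-open q)))) (row-K i i<n))
        (trans (closing q (i ℕ.+ offsetOf (x-open q)) j (ℕ.+-mono-< i<n (offsetOf<n (x-open q) v))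
            (trans (cong reduce (sym (ℕ.+-suc i _))) (h tt)))
          (cong (_+ blockValue q j) (sym (column-net j))))))
      where
      go : ∀ K K′ X X′ → K + X ≡ K′ + X′ → - K - X ≡ - K′ - X′
      go K K′ X X′ e = trans {j = - (K + X)} (solve (K ∷ X ∷ [])) (trans (cong -_ e) (solve (K′ ∷ X′ ∷ [])))
    agree i j i<n j<n (y-close q) v h = cong just (go (Line.K (row i i<n)) (Line.K (column j j<n)) (blockValue q (reduce (i ℕ.+ offsetOf (y-open q)))) (blockValue q j) (+ 4 * + m)
      (trans (cong (_+ blockValue q (reduce (i ℕ.+ offsetOf (y-open q)))) (row-K i i<n))
        (trans (closing q (i ℕ.+ offsetOf (y-open q)) j (ℕ.+-mono-< i<n (offsetOf<n (y-open q) v))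
            (trans (cong reduce (sym (ℕ.+-suc i _))) (h tt)))
          (cong (_+ blockValue q j) (sym (column-net j))))))
      where
      go : ∀ K K′ X X′ Y → K + X ≡ K′ + X′ → K + (X + Y) ≡ K′ + (X′ + Y)
      go K K′ X X′ Y e = trans (sym (ℤ.+-assoc K X Y)) (trans (cong (_+ Y) e) (ℤ.+-assoc K′ X′ Y))

    -- The net is written by column number rather than by class, so that the coverage proof can
    -- split on column 0.
    cell : ℕ → Kind → Maybe ℤ
    cell j a-cell      = just (- (B j + C j))
    cell j b-cell      = just (B j)
    cell j c-cell      = just (C j)
    cell j gap₁        = nothing
    cell j gap₂        = nothing
    cell j gap₃        = nothing
    cell j (x-open q)  = just (blockValue q j)
    cell j (x-close q) = just (- net j - blockValue q j)
    cell j (y-open q)  = just (- (blockValue q j + + 4 * + m))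
    cell j (y-close q) = just (net j + (blockValue q j + + 4 * + m))

    column-content : ∀ j (j<n : j ℕ.< n) k → cell j k ≡ LineProperties.content (s≤s z≤n) (column j j<n) k
    column-content j j<n a-cell      = refl
    column-content j j<n b-cell      = refl
    column-content j j<n c-cell      = refl
    column-content j j<n gap₁        = refl
    column-content j j<n gap₂        = refl
    column-content j j<n gap₃        = refl
    column-content j j<n (x-open q)  = refl
    column-content j j<n (x-close q) = cong (λ z → just (- z - blockValue q j)) (sym (column-net j))
    column-content j j<n (y-open q)  = refl
    column-content j j<n (y-close q) = cong (λ z → just (z + (blockValue q j + + 4 * + m))) (sym (column-net j))

  -- The array

  module Construction (μ p : ℕ) (p≤μ : p ℕ.≤ μ) where
    open Offsets μ p p≤μ
    open Lines μ p p≤μ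
    open Rows-and-columns μ p p≤μ

    array : PArray n
    array i j = cell (toℕ j) (kindAt (toℕ j ℕ.+ (n ℕ.∸ toℕ i)))

    private
      reduce-back : ∀ i j → i ℕ.< n → j ℕ.< n → reduce (i ℕ.+ reduce (j ℕ.+ (n ℕ.∸ i))) ≡ j
      reduce-back i j i<n j<n with j ℕ.+ (n ℕ.∸ i) ℕ.<? n
      ... | yes _ = trans (cong reduce (trans (swap i j (n ℕ.∸ i)) (cong (ℕ._+ j) (ℕ.m+[n∸m]≡n (ℕ.<⇒≤ i<n))))) (reduce-≥ j)
        where
        swap : ∀ i j r → i ℕ.+ (j ℕ.+ r) ≡ i ℕ.+ r ℕ.+ j
        swap i j r = ℕ-Solver.solve (i ∷ j ∷ r ∷ [])
      ... | no ¬< = trans (cong reduce (ℕ.+-cancelʳ-≡ n _ _ (trans (ℕ.+-assoc i _ n)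
                      (trans (cong (i ℕ.+_) (ℕ.m∸n+n≡m (ℕ.≮⇒≥ ¬<)))
                        (trans (swap i j (n ℕ.∸ i)) (cong (j ℕ.+_) (ℕ.m+[n∸m]≡n (ℕ.<⇒≤ i<n)))))))) (reduce-< j<n)
        where
        swap : ∀ i j r → i ℕ.+ (j ℕ.+ r) ≡ j ℕ.+ (i ℕ.+ r)
        swap i j r = ℕ-Solver.solve (i ∷ j ∷ r ∷ [])

      offset-of-cell : ∀ i j → i ℕ.< n → j ℕ.< n → let k = kindAt (j ℕ.+ (n ℕ.∸ i)) in
                       NotGap k → reduce (i ℕ.+ offsetOf k) ≡ j
      offset-of-cell i j i<n j<n f =
        trans (cong (λ z → reduce (i ℕ.+ z)) (offsetOf-kindOf (reduce (j ℕ.+ (n ℕ.∸ i))) f)) (reduce-back i j i<n j<n)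

      rowEntry : Fin n → ℕ → Maybe ℤ
      rowEntry i t = LineProperties.content (s≤s z≤n) (row (toℕ i) (Fin.toℕ<n i)) (kindAt (t ℕ.+ (n ℕ.∸ toℕ i)))

      row-entries : ∀ i → rowEntries array i ≡ entries (rowEntry i) n
      row-entries i = rowEntries-entries array i (rowEntry i) λ j →
        trans (column-content (toℕ j) (Fin.toℕ<n j) (kindAt (toℕ j ℕ.+ (n ℕ.∸ toℕ i)))) (sym (agree (toℕ i) (toℕ j) (Fin.toℕ<n i) (Fin.toℕ<n j) (kindAt (toℕ j ℕ.+ (n ℕ.∸ toℕ i)))
          (valid-kindOf (reduce (toℕ j ℕ.+ (n ℕ.∸ toℕ i)))) (offset-of-cell (toℕ i) (toℕ j) (Fin.toℕ<n i) (Fin.toℕ<n j))))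

      columnEntry : Fin n → ℕ → Maybe ℤ
      columnEntry j t = LineProperties.content (s≤s z≤n) (column (toℕ j) (Fin.toℕ<n j)) (kindAt (toℕ j ℕ.+ (n ℕ.∸ t)))

      column-entries : ∀ j → colEntries array j ≡ entries (columnEntry j) n
      column-entries j = colEntries-entries array j (columnEntry j) λ i →
        column-content (toℕ j) (Fin.toℕ<n j) (kindAt (toℕ j ℕ.+ (n ℕ.∸ toℕ i)))

      row-good : ∀ i → Good n (4 ℕ.* p ℕ.+ 3) (rowEntries array i)
      row-good i = subst (Good n (4 ℕ.* p ℕ.+ 3)) (sym (row-entries i))
        (Walks.ascending μ p p≤μ (row (toℕ i) (Fin.toℕ<n i)) (toℕ i) (Fin.toℕ<n i))

      column-good : ∀ j → Good n (4 ℕ.* p ℕ.+ 3) (colEntries array j)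
      column-good j = subst (Good n (4 ℕ.* p ℕ.+ 3)) (sym (column-entries j))
        (Walks.descending μ p p≤μ (column (toℕ j) (Fin.toℕ<n j)) (toℕ j) (Fin.toℕ<n j))

      -- Every absolute value from 1 to nk occurs

      record Covered (x : ℕ) : Set where
        constructor covered
        field
          col     : ℕ
          col<n   : col ℕ.< n
          kind    : Kind
          valid   : Valid p kind
          notGap  : NotGap kind
          content : cell col kind ≡ just (+ x) ⊎ cell col kind ≡ just (- (+ x))

      -- In column j the row j - d has offset d, both differences taken mod n.
      placed : ∀ j d → j ℕ.< n → d ℕ.< n → reduce (j ℕ.+ (n ℕ.∸ reduce (j ℕ.+ (n ℕ.∸ d)))) ≡ d
      placed j d j<n d<n = inverse (reduce (j ℕ.+ (n ℕ.∸ d))) (reduce<n (ℕ.+-mono-<-≤ j<n (ℕ.m∸n≤m n d)))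
                             (reduce-back d j d<n j<n)
        where
        inverse : ∀ i → i ℕ.< n → reduce (d ℕ.+ i) ≡ j → reduce (j ℕ.+ (n ℕ.∸ i)) ≡ d
        inverse i i<n refl with d ℕ.+ i ℕ.<? n
        ... | yes _ = trans (cong reduce (trans (ring d i (n ℕ.∸ i)) (cong (ℕ._+ d) (ℕ.m+[n∸m]≡n (ℕ.<⇒≤ i<n))))) (reduce-≥ d)
          where
          ring : ∀ d i r → d ℕ.+ i ℕ.+ r ≡ i ℕ.+ r ℕ.+ d
          ring d i r = ℕ-Solver.solve (d ∷ i ∷ r ∷ [])
        ... | no ¬< = trans (cong reduce (ℕ.+-cancelʳ-≡ n _ _ (trans (swap (d ℕ.+ i ℕ.∸ n) (n ℕ.∸ i) n)
                        (trans (cong (ℕ._+ (n ℕ.∸ i)) (ℕ.m∸n+n≡m (ℕ.≮⇒≥ ¬<)))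
                          (trans (ℕ.+-assoc d i _) (cong (d ℕ.+_) (ℕ.m+[n∸m]≡n (ℕ.<⇒≤ i<n)))))))) (reduce-< d<n)
          where
          swap : ∀ x r n → x ℕ.+ r ℕ.+ n ≡ x ℕ.+ n ℕ.+ r
          swap x r n = ℕ-Solver.solve (x ∷ r ∷ n ∷ [])

      occurs : ∀ x → Covered x → ∃[ i ] ∃[ j ] (array i j ≡ just (+ x) ⊎ array i j ≡ just (- (+ x)))
      occurs x (covered j j<n k v f e) = fromℕ< i<n , fromℕ< j<n , transport e
        where
        i = reduce (j ℕ.+ (n ℕ.∸ offsetOf k))
        i<n : i ℕ.< n
        i<n = reduce<n (ℕ.+-mono-<-≤ j<n (ℕ.m∸n≤m n (offsetOf k)))
        kind : kindAt (j ℕ.+ (n ℕ.∸ i)) ≡ k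
        kind = trans (cong kindOf (placed j (offsetOf k) j<n (offsetOf<n k v))) (kindOf-offsetOf k v f)
        same : array (fromℕ< i<n) (fromℕ< j<n) ≡ cell j k
        same = trans (cong₂ (λ j i → cell j (kindAt (j ℕ.+ (n ℕ.∸ i)))) (Fin.toℕ-fromℕ< j<n) (Fin.toℕ-fromℕ< i<n))
          (cong (cell j) kind)
        transport : cell j k ≡ just (+ x) ⊎ cell j k ≡ just (- (+ x)) →
                    array (fromℕ< i<n) (fromℕ< j<n) ≡ just (+ x) ⊎ array (fromℕ< i<n) (fromℕ< j<n) ≡ just (- (+ x))
        transport (inj₁ e) = inj₁ (trans same e)
        transport (inj₂ e) = inj₂ (trans same e)

      -- Reduces an equation to a ring identity: the difference of its sides is `k` times that of a
      -- known equation.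
      linear-combination : ∀ {x y s t} k → s ≡ t → x - y ≡ k * (s - t) → x ≡ y
      linear-combination {x} {y} {s} k refl e = ℤ.i-j≡0⇒i≡j x y
        (trans e (trans (cong (k *_) (ℤ.+-inverseʳ s)) (ℤ.*-zeroʳ k)))

      diagonal : Class → ℤ
      diagonal k = - (valueAt bForm k + valueAt cForm k)

      hit-a : ∀ k → Member k → ∀ x → diagonal k ≡ + x ⊎ diagonal k ≡ - (+ x) → Covered x
      hit-a k h x e = covered (index k) (index<n k h) a-cell tt tt (there e)
        where
        same : cell (index k) a-cell ≡ just (diagonal k)
        same = cong (λ z → just (diagonal z)) (classify-index k h)
        there : diagonal k ≡ + x ⊎ diagonal k ≡ - (+ x) →
                cell (index k) a-cell ≡ just (+ x) ⊎ cell (index k) a-cell ≡ just (- (+ x))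
        there (inj₁ e) = inj₁ (trans same (cong just e))
        there (inj₂ e) = inj₂ (trans same (cong just e))

      hit-b : ∀ k → Member k → ∀ x → valueAt bForm k ≡ + x ⊎ valueAt bForm k ≡ - (+ x) → Covered x
      hit-b k h x e = covered (index k) (index<n k h) b-cell tt tt (there e)
        where
        same : cell (index k) b-cell ≡ just (valueAt bForm k)
        same = cong (λ z → just (valueAt bForm z)) (classify-index k h)
        there : valueAt bForm k ≡ + x ⊎ valueAt bForm k ≡ - (+ x) →
                cell (index k) b-cell ≡ just (+ x) ⊎ cell (index k) b-cell ≡ just (- (+ x))
        there (inj₁ e) = inj₁ (trans same (cong just e))
        there (inj₂ e) = inj₂ (trans same (cong just e))

      hit-c : ∀ k → Member k → ∀ x → valueAt cForm k ≡ + x ⊎ valueAt cForm k ≡ - (+ x) → Covered x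
      hit-c k h x e = covered (index k) (index<n k h) c-cell tt tt (there e)
        where
        same : cell (index k) c-cell ≡ just (valueAt cForm k)
        same = cong (λ z → just (valueAt cForm z)) (classify-index k h)
        there : valueAt cForm k ≡ + x ⊎ valueAt cForm k ≡ - (+ x) →
                cell (index k) c-cell ≡ just (+ x) ⊎ cell (index k) c-cell ≡ just (- (+ x))
        there (inj₁ e) = inj₁ (trans same (cong just e))
        there (inj₂ e) = inj₂ (trans same (cong just e))

      slice : (P : ℕ → Set) → ∀ a c {y} → ¬ (y ℕ.< a ℕ.* m) → y ℕ.< (a ℕ.+ c) ℕ.* m →
              (∀ u → u ℕ.< c ℕ.* m → P (a ℕ.* m ℕ.+ u)) → P y
      slice P a c {y} y≮ y< f = subst P y≡ (f (y ℕ.∸ a ℕ.* m) (ℕ.+-cancelˡ-< (a ℕ.* m) _ _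
        (subst (ℕ._< a ℕ.* m ℕ.+ c ℕ.* m) (sym y≡) (subst (y ℕ.<_) (ℕ.*-distribʳ-+ m a c) y<))))
        where
        y≡ : a ℕ.* m ℕ.+ (y ℕ.∸ a ℕ.* m) ≡ y
        y≡ = ℕ.m+[n∸m]≡n (ℕ.≮⇒≥ y≮)

      1*m : ∀ {u} → u ℕ.< 1 ℕ.* m → u ℕ.< m
      1*m {u} = subst (u ℕ.<_) (ℕ.*-identityˡ m)

      cast : ∀ a u → + suc (a ℕ.* m ℕ.+ u) ≡ + 1 + (+ a * + m + + u)
      cast a u = cong (λ z → + 1 + (z + + u)) (ℤ.pos-* a m)

      positive : ∀ {x v z : ℤ} → x ≡ v → z ≡ v → z ≡ x
      positive e e′ = trans e′ (sym e)

      negated : ∀ {x v z} → x ≡ v → z ≡ - v → z ≡ - x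
      negated refl e = e

      complement : ∀ {v N} → v ℕ.< N → suc v ℕ.+ (N ℕ.∸ suc v) ≡ N
      complement = ℕ.m+[n∸m]≡n

      complement< : ∀ {v N} → v ℕ.< N → N ℕ.∸ suc v ℕ.< N
      complement< {v} {N} v<N = ℕ.≤-trans (s≤s (ℕ.m≤n+m (N ℕ.∸ suc v) v)) (ℕ.≤-reflexive (complement v<N))

      -- Odd values are diagonal entries of `odd₁`, even ones of `even₀`, except 2m, which column 0
      -- supplies.
      segment₁ : ∀ y → y ℕ.< 2 ℕ.* m → Covered (suc y)
      segment₁ y y<2m = subst (λ z → Covered (suc z)) (fromParity-parity y)
        (go (parity y) (subst (ℕ._< 2 ℕ.* m) (sym (fromParity-parity y)) y<2m))
        where
        go : ∀ π → fromParity π ℕ.< 2 ℕ.* m → Covered (suc (fromParity π))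
        go (even u) l = hit-a (odd₁ at u) (ℕ.*-cancelˡ-< 2 u m l) _
          (inj₂ (negated (cong (λ z → + 1 + z) (ℤ.pos-* 2 u)) (ring (+ m) (+ u))))
          where
          ring : ∀ M U → - (+ 8 * M + + 1 * U + + 1 + (- + 8 * M + + 1 * U + + 0)) ≡ - (+ 1 + + 2 * U)
          ring M U = solve (M ∷ U ∷ [])
        go (odd u) l with suc u ℕ.<? m
        ... | yes h = hit-a (even₀ at u) h _ (inj₂ (negated (cong (λ z → + 2 + z) (ℤ.pos-* 2 u)) (ring (+ m) (+ u))))
          where
          ring : ∀ M U → - (- + 11 * M + + 1 * U + + 0 + (+ 11 * M + + 1 * U + + 2)) ≡ - (+ 2 + + 2 * U)
          ring M U = solve (M ∷ U ∷ [])
        ... | no ¬h = hit-a (origin at 0) refl _ (inj₂ (negated (cong (λ z → + 2 + z) (ℤ.pos-* 2 u))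
                        (linear-combination (- + 2) (cong +_ m≡) (ring (+ m) (+ u)))))
          where
          m≡ : m ≡ suc u
          m≡ = ℕ.≤-antisym (ℕ.≮⇒≥ ¬h) (ℕ.*-cancelˡ-< 2 u m (ℕ.<⇒≤ l))
          ring : ∀ M U → - (- + 9 * M + + 0 * + 0 + - + 1 + (+ 11 * M + + 0 * + 0 + + 1)) - - (+ 2 + + 2 * U) ≡
                         - + 2 * (M - (+ 1 + U))
          ring M U = solve (M ∷ U ∷ [])

      segment₂ : ∀ u → u ℕ.< m → Covered (suc (2 ℕ.* m ℕ.+ u))
      segment₂ u h = hit-b (odd₀ at u) h _ (inj₁ (positive (cast 2 u) (ring (+ m) (+ u))))
        where
        ring : ∀ M U → + 2 * M + + 1 * U + + 1 ≡ + 1 + (+ 2 * M + U)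
        ring M U = solve (M ∷ U ∷ [])

      -- These are the diagonal entries 5m - w with w < 2m: even w from `even₁`, odd w from `odd₀`.
      segment₃ : ∀ v → v ℕ.< 2 ℕ.* m → Covered (suc (3 ℕ.* m ℕ.+ v))
      segment₃ v v<2m = go (parity w) (fromParity-parity w)
        where
        w = 2 ℕ.* m ℕ.∸ suc v
        w<2m : w ℕ.< 2 ℕ.* m
        w<2m = complement< v<2m
        sum : ∀ {z} → z ≡ w → + 1 + + v + + z ≡ + 2 * + m
        sum refl = trans (cong +_ (complement v<2m)) (ℤ.pos-* 2 m)
        go : ∀ π → fromParity π ≡ w → Covered (suc (3 ℕ.* m ℕ.+ v))
        go (even u) e = hit-a (even₁ at u) (ℕ.*-cancelˡ-< 2 u m (subst (ℕ._< 2 ℕ.* m) (sym e) w<2m)) _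
          (inj₁ (positive (cast 3 v) (linear-combination (- + 1)
            (trans (cong (λ z → + 1 + + v + z) (sym (ℤ.pos-* 2 u))) (sum e)) (ring (+ m) (+ u) (+ v)))))
          where
          ring : ∀ M U V → - (- + 10 * M + + 1 * U + - + 1 + (+ 5 * M + + 1 * U + + 1)) - (+ 1 + (+ 3 * M + V)) ≡
                           - + 1 * (+ 1 + V + + 2 * U - + 2 * M)
          ring M U V = solve (M ∷ U ∷ V ∷ [])
        go (odd u) e = hit-a (odd₀ at u) (ℕ.*-cancelˡ-< 2 u m (ℕ.<⇒≤ (subst (ℕ._< 2 ℕ.* m) (sym e) w<2m))) _
          (inj₁ (positive (cast 3 v) (linear-combination (- + 1)
            (trans (cong (λ z → + 1 + + v + (+ 1 + z)) (sym (ℤ.pos-* 2 u))) (sum e)) (ring (+ m) (+ u) (+ v)))))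
          where
          ring : ∀ M U V → - (+ 2 * M + + 1 * U + + 1 + (- + 7 * M + + 1 * U + + 0)) - (+ 1 + (+ 3 * M + V)) ≡
                           - + 1 * (+ 1 + V + (+ 1 + + 2 * U) - + 2 * M)
          ring M U V = solve (M ∷ U ∷ V ∷ [])

      segment₅ : ∀ u → u ℕ.< m → Covered (suc (5 ℕ.* m ℕ.+ u))
      segment₅ u h = hit-c (even₁ at u) h _ (inj₁ (positive (cast 5 u) (ring (+ m) (+ u))))
        where
        ring : ∀ M U → + 5 * M + + 1 * U + + 1 ≡ + 1 + (+ 5 * M + U)
        ring M U = solve (M ∷ U ∷ [])

      segment₆ : ∀ v → v ℕ.< m → Covered (suc (6 ℕ.* m ℕ.+ v))
      segment₆ v h = hit-c (odd₀ at m ℕ.∸ suc v) (complement< h) _ (inj₂ (negated (cast 6 v)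
        (linear-combination (+ 1) (cong +_ (complement h)) (ring (+ m) (+ (m ℕ.∸ suc v)) (+ v)))))
        where
        ring : ∀ M U V → - + 7 * M + + 1 * U + + 0 - - (+ 1 + (+ 6 * M + V)) ≡ + 1 * (+ 1 + V + U - M)
        ring M U V = solve (M ∷ U ∷ V ∷ [])

      segment₇ : ∀ v → v ℕ.< m → Covered (suc (7 ℕ.* m ℕ.+ v))
      segment₇ v h = hit-c (odd₁ at m ℕ.∸ suc v) (complement< h) _ (inj₂ (negated (cast 7 v)
        (linear-combination (+ 1) (cong +_ (complement h)) (ring (+ m) (+ (m ℕ.∸ suc v)) (+ v)))))
        where
        ring : ∀ M U V → - + 8 * M + + 1 * U + + 0 - - (+ 1 + (+ 7 * M + V)) ≡ + 1 * (+ 1 + V + U - M)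
        ring M U V = solve (M ∷ U ∷ V ∷ [])

      segment₈ : ∀ u → u ℕ.< m → Covered (suc (8 ℕ.* m ℕ.+ u))
      segment₈ u h = hit-b (odd₁ at u) h _ (inj₁ (positive (cast 8 u) (ring (+ m) (+ u))))
        where
        ring : ∀ M U → + 8 * M + + 1 * U + + 1 ≡ + 1 + (+ 8 * M + U)
        ring M U = solve (M ∷ U ∷ [])

      -- First 9m + 1 from column 0, then the sizes 10m + 1 - u of `even₁` and 11m - u of `even₀`,
      -- both falling in u.
      segment₉ : ∀ v → v ℕ.< 2 ℕ.* m → Covered (suc (9 ℕ.* m ℕ.+ v))
      segment₉ zero _ = hit-b (origin at 0) refl _ (inj₂ (negated (cast 9 0) (ring (+ m))))
        where
        ring : ∀ M → - + 9 * M + + 0 * + 0 + - + 1 ≡ - (+ 1 + (+ 9 * M + + 0))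
        ring M = solve (M ∷ [])
      segment₉ (suc v) l with v ℕ.<? m
      ... | yes h = hit-b (even₁ at m ℕ.∸ suc v) (complement< h) _ (inj₂ (negated (cast 9 (suc v))
              (linear-combination (+ 1) (cong +_ (complement h)) (ring (+ m) (+ (m ℕ.∸ suc v)) (+ v)))))
        where
        ring : ∀ M U V → - + 10 * M + + 1 * U + - + 1 - - (+ 1 + (+ 9 * M + (+ 1 + V))) ≡ + 1 * (+ 1 + V + U - M)
        ring M U V = solve (M ∷ U ∷ V ∷ [])
      ... | no ¬h = hit-b (even₀ at u) (ℕ.≤-trans (ℕ.m≤n+m (2 ℕ.+ u) w) (ℕ.≤-reflexive (trans (swap w u) (complement sw<m)))) _
              (inj₂ (negated (cast 9 (suc v)) (linear-combination (+ 1)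
                (cong₂ _+_ (cong +_ (complement sw<m)) (cong +_ (sym v≡))) (ring (+ m) (+ u) (+ v) (+ w)))))
        where
        w = v ℕ.∸ m
        v≡ : m ℕ.+ w ≡ v
        v≡ = ℕ.m+[n∸m]≡n (ℕ.≮⇒≥ ¬h)
        sw<m : suc w ℕ.< m
        sw<m = ℕ.+-cancelˡ-< m _ _ (ℕ.≤-trans (ℕ.≤-reflexive (cong suc (trans (ℕ.+-suc m w) (cong suc v≡))))
          (ℕ.≤-trans l (ℕ.≤-reflexive (cong (m ℕ.+_) (ℕ.+-identityʳ m)))))
        u = m ℕ.∸ suc (suc w)
        swap : ∀ w u → w ℕ.+ (2 ℕ.+ u) ≡ suc (suc w) ℕ.+ u
        swap w u = ℕ-Solver.solve (w ∷ u ∷ [])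
        ring : ∀ M U V W → - + 11 * M + + 1 * U + + 0 - - (+ 1 + (+ 9 * M + (+ 1 + V))) ≡
                           + 1 * (+ 2 + W + U + V - (M + (M + W)))
        ring M U V W = solve (M ∷ U ∷ V ∷ W ∷ [])

      segment₁₁ : ∀ v → v ℕ.< m → Covered (suc (11 ℕ.* m ℕ.+ v))
      segment₁₁ zero _ = hit-c (origin at 0) refl _ (inj₁ (positive (cast 11 0) (ring (+ m))))
        where
        ring : ∀ M → + 11 * M + + 0 * + 0 + + 1 ≡ + 1 + (+ 11 * M + + 0)
        ring M = solve (M ∷ [])
      segment₁₁ (suc u) h = hit-c (even₀ at u) h _ (inj₁ (positive (cast 11 (suc u)) (ring (+ m) (+ u))))
        where
        ring : ∀ M U → + 11 * M + + 1 * U + + 2 ≡ + 1 + (+ 11 * M + (+ 1 + U))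
        ring M U = solve (M ∷ U ∷ [])

      -- In absolute value the diagonal takes 1 to 2m and 3m + 1 to 5m, `B` takes 2m + 1 to 3m and
      -- 8m + 1 to 11m, and `C` takes 5m + 1 to 8m and 11m + 1 to 12m.
      small : ∀ y → y ℕ.< 12 ℕ.* m → Covered (suc y)
      small y y<12m with y ℕ.<? 2 ℕ.* m | y ℕ.<? 3 ℕ.* m | y ℕ.<? 5 ℕ.* m | y ℕ.<? 6 ℕ.* m
                       | y ℕ.<? 7 ℕ.* m | y ℕ.<? 8 ℕ.* m | y ℕ.<? 9 ℕ.* m | y ℕ.<? 11 ℕ.* m
      ... | yes l | _     | _     | _     | _     | _     | _     | _     = segment₁ y l
      ... | no ≮  | yes l | _     | _     | _     | _     | _     | _     = slice (λ z → Covered (suc z)) 2 1 ≮ l λ u h → segment₂ u (1*m h)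
      ... | _     | no ≮  | yes l | _     | _     | _     | _     | _     = slice (λ z → Covered (suc z)) 3 2 ≮ l segment₃
      ... | _     | _     | no ≮  | yes l | _     | _     | _     | _     = slice (λ z → Covered (suc z)) 5 1 ≮ l λ u h → segment₅ u (1*m h)
      ... | _     | _     | _     | no ≮  | yes l | _     | _     | _     = slice (λ z → Covered (suc z)) 6 1 ≮ l λ u h → segment₆ u (1*m h)
      ... | _     | _     | _     | _     | no ≮  | yes l | _     | _     = slice (λ z → Covered (suc z)) 7 1 ≮ l λ u h → segment₇ u (1*m h)
      ... | _     | _     | _     | _     | _     | no ≮  | yes l | _     = slice (λ z → Covered (suc z)) 8 1 ≮ l λ u h → segment₈ u (1*m h)
      ... | _     | _     | _     | _     | _     | _     | no ≮  | yes l = slice (λ z → Covered (suc z)) 9 2 ≮ l segment₉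
      ... | _     | _     | _     | _     | _     | _     | _     | no ≮  = slice (λ z → Covered (suc z)) 11 1 ≮ y<12m λ u h → segment₁₁ u (1*m h)

      module Block (q : ℕ) (q<p : q ℕ.< p) where

        entry : ℕ → ℕ
        entry r = suc (12 ℕ.* m ℕ.+ (r ℕ.+ q ℕ.* (16 ℕ.* m)))

        cast₀ : ∀ u → + entry u ≡ + 1 + (+ 12 * + m + (+ u + + q * (+ 16 * + m)))
        cast₀ u = cong (λ z → + 1 + z) (cong₂ _+_ (ℤ.pos-* 12 m)
          (cong (λ z → + u + z) (trans (ℤ.pos-* q (16 ℕ.* m)) (cong (+ q *_) (ℤ.pos-* 16 m)))))

        castₐ : ∀ a u → + entry (a ℕ.* m ℕ.+ u) ≡ + 1 + (+ 12 * + m + (+ a * + m + + u + + q * (+ 16 * + m)))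
        castₐ a u = trans (cast₀ (a ℕ.* m ℕ.+ u))
          (cong (λ z → + 1 + (+ 12 * + m + (z + + u + + q * (+ 16 * + m)))) (ℤ.pos-* a m))

        sum : ∀ {u} → u ℕ.< n → + 1 + + u + + (n ℕ.∸ suc u) ≡ + 4 * + m
        sum u<n = trans (cong +_ (complement u<n)) (ℤ.pos-* 4 m)

        opens : ∀ u → u ℕ.< n → Covered (entry u)
        opens u u<n = covered j (complement< u<n) (x-open q) q<p tt
          (inj₁ (cong just (positive (cast₀ u) (linear-combination (- + 1) (sum u<n) (ring (+ m) (+ q) (+ u) (+ j))))))
          where
          j = n ℕ.∸ suc u
          ring : ∀ M Q U J → + 16 * M * (Q + + 1) - J - (+ 1 + (+ 12 * M + (U + Q * (+ 16 * M)))) ≡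
                             - + 1 * (+ 1 + U + J - + 4 * M)
          ring M Q U J = solve (M ∷ Q ∷ U ∷ J ∷ [])

        opens′ : ∀ u → u ℕ.< n → Covered (entry (4 ℕ.* m ℕ.+ u))
        opens′ u u<n = covered j (complement< u<n) (y-open q) q<p tt
          (inj₂ (cong just (negated (castₐ 4 u) (linear-combination (+ 1) (sum u<n) (ring (+ m) (+ q) (+ u) (+ j))))))
          where
          j = n ℕ.∸ suc u
          ring : ∀ M Q U J → - (+ 16 * M * (Q + + 1) - J + + 4 * M) - - (+ 1 + (+ 12 * M + (+ 4 * M + U + Q * (+ 16 * M)))) ≡
                             + 1 * (+ 1 + U + J - + 4 * M)
          ring M Q U J = solve (M ∷ Q ∷ U ∷ J ∷ [])

        -- Columns j ≥ 1 give all of the third quarter but its least value 16mq + 20m + 1, which the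
        -- smaller net of column 0 supplies.
        closes : ∀ u → u ℕ.< n → Covered (entry (8 ℕ.* m ℕ.+ u))
        closes zero _ = covered 0 (s≤s z≤n) (x-close q) q<p tt
          (inj₂ (cong just (negated (castₐ 8 0) (ring (+ m) (+ q)))))
          where
          ring : ∀ M Q → - (+ 4 * M + + 1) - (+ 16 * M * (Q + + 1) - + 0) ≡
                         - (+ 1 + (+ 12 * M + (+ 8 * M + + 0 + Q * (+ 16 * M))))
          ring M Q = solve (M ∷ Q ∷ [])
        closes (suc v) l = covered (suc w) (ℕ.≤-trans (s≤s (s≤s (ℕ.m≤n+m w v))) (ℕ.≤-reflexive (complement l))) (x-close q) q<p tt
          (inj₂ (cong just (negated (castₐ 8 (suc v)) (linear-combination (+ 1) (sum l) (ring (+ m) (+ q) (+ v) (+ w))))))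
          where
          w = n ℕ.∸ suc (suc v)
          ring : ∀ M Q V W → - (+ 8 * M + + 1) - (+ 16 * M * (Q + + 1) - (+ 1 + W)) -
                             - (+ 1 + (+ 12 * M + (+ 8 * M + (+ 1 + V) + Q * (+ 16 * M)))) ≡
                             + 1 * (+ 1 + (+ 1 + V) + W - + 4 * M)
          ring M Q V W = solve (M ∷ Q ∷ V ∷ W ∷ [])

        closes′ : ∀ u → u ℕ.< n → Covered (entry (12 ℕ.* m ℕ.+ u))
        closes′ zero _ = covered 0 (s≤s z≤n) (y-close q) q<p tt
          (inj₁ (cong just (positive (castₐ 12 0) (ring (+ m) (+ q)))))
          where
          ring : ∀ M Q → + 4 * M + + 1 + (+ 16 * M * (Q + + 1) - + 0 + + 4 * M) ≡
                         + 1 + (+ 12 * M + (+ 12 * M + + 0 + Q * (+ 16 * M)))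
          ring M Q = solve (M ∷ Q ∷ [])
        closes′ (suc v) l = covered (suc w) (ℕ.≤-trans (s≤s (s≤s (ℕ.m≤n+m w v))) (ℕ.≤-reflexive (complement l))) (y-close q) q<p tt
          (inj₁ (cong just (positive (castₐ 12 (suc v)) (linear-combination (- + 1) (sum l) (ring (+ m) (+ q) (+ v) (+ w))))))
          where
          w = n ℕ.∸ suc (suc v)
          ring : ∀ M Q V W → + 8 * M + + 1 + (+ 16 * M * (Q + + 1) - (+ 1 + W) + + 4 * M) -
                             (+ 1 + (+ 12 * M + (+ 12 * M + (+ 1 + V) + Q * (+ 16 * M)))) ≡
                             - + 1 * (+ 1 + (+ 1 + V) + W - + 4 * M)
          ring M Q V W = solve (M ∷ Q ∷ V ∷ W ∷ [])

        block : ∀ r → r ℕ.< 16 ℕ.* m → Covered (entry r)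
        block r r<16m with r ℕ.<? 4 ℕ.* m | r ℕ.<? 8 ℕ.* m | r ℕ.<? 12 ℕ.* m
        ... | yes l | _     | _     = opens r l
        ... | no ≮  | yes l | _     = slice (λ r → Covered (entry r)) 4 4 ≮ l opens′
        ... | _     | no ≮  | yes l = slice (λ r → Covered (entry r)) 8 4 ≮ l closes
        ... | _     | _     | no ≮  = slice (λ r → Covered (entry r)) 12 4 ≮ r<16m closes′

      large : ∀ z → z ℕ.< p ℕ.* (16 ℕ.* m) → Covered (suc (12 ℕ.* m ℕ.+ z))
      large z z< = subst (λ z → Covered (suc (12 ℕ.* m ℕ.+ z))) (sym (ℕ.m≡m%n+[m/n]*n z (16 ℕ.* m)))
        (Block.block (z ℕ./ (16 ℕ.* m)) (ℕ.m<n*o⇒m/o<n z<) (z ℕ.% (16 ℕ.* m)) (ℕ.m%n<n z (16 ℕ.* m)))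

      all-covered : ∀ y → y ℕ.< n ℕ.* (4 ℕ.* p ℕ.+ 3) → Covered (suc y)
      all-covered y y< with y ℕ.<? 12 ℕ.* m
      ... | yes l = small y l
      ... | no ≮ = subst (λ z → Covered (suc z)) y≡ (large (y ℕ.∸ 12 ℕ.* m) (ℕ.+-cancelˡ-< (12 ℕ.* m) _ _
              (subst (ℕ._< 12 ℕ.* m ℕ.+ p ℕ.* (16 ℕ.* m)) (sym y≡) (subst (y ℕ.<_) (ring m p) y<))))
        where
        y≡ : 12 ℕ.* m ℕ.+ (y ℕ.∸ 12 ℕ.* m) ≡ y
        y≡ = ℕ.m+[n∸m]≡n (ℕ.≮⇒≥ ≮)
        ring : ∀ m p → 4 ℕ.* m ℕ.* (4 ℕ.* p ℕ.+ 3) ≡ 12 ℕ.* m ℕ.+ p ℕ.* (16 ℕ.* m)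
        ring m p = ℕ-Solver.solve (m ∷ p ∷ [])

      vanishes : ∀ N {x} → x ≡ + 0 → x ≡[mod N ] (+ 0)
      vanishes N refl = N ℕ.∣0

    isHeffter : IsHeffter n (4 ℕ.* p ℕ.+ 3) array
    isHeffter = record
      { rowCount = λ i → Good.size (row-good i)
      ; colCount = λ j → Good.size (column-good j)
      ; rowSum   = λ i → vanishes (hmod n (4 ℕ.* p ℕ.+ 3)) (Good.total (row-good i))
      ; colSum   = λ j → vanishes (hmod n (4 ℕ.* p ℕ.+ 3)) (Good.total (column-good j))
      ; covers   = λ { (suc y) _ y< → occurs (suc y) (all-covered y y<) }
      }

    isGloballySimple : IsGloballySimple n (4 ℕ.* p ℕ.+ 3) array
    isGloballySimple = (λ i → Good.simple (row-good i)) , (λ j → Good.simple (column-good j))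

-- Reduction to n = 4m with p < m

open import Data.Nat using (ℕ; _+_; _*_; _∸_; _≤_; _%_; _/_)
open import Data.Nat using (_<_; suc; z≤n; s≤s)
open import Data.Nat.DivMod using (m≡m%n+[m/n]*n)
open import Data.Nat.GCD using (gcd)
open import Data.Nat.Properties using (*-comm; *-cancelˡ-<; <-≤-trans; m<m+n)
open import Data.Product using (Σ; ∃; ∃-syntax; _×_; _,_)
open import Relation.Binary.PropositionalEquality using (_≡_; sym; trans; cong; subst)

theorem4p6 : (n p ε : ℕ) → n % 4 ≡ 0 → 4 * p + 3 ≤ n →
    1 ≤ ε → 2 * ε ≤ n ∸ 4 * p → gcd ε n ≡ 1 →
    (∃[ α ] (gcd α n ≡ 1 × 2 * p + ε ≤ α × α ≤ n ∸ ε ∸ 2 * p)) →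
    ∃[ A ] (IsHeffter n (4 * p + 3) A × IsGloballySimple n (4 * p + 3) A)
theorem4p6 n p ε n%4≡0 4p+3≤n _ _ _ _ =
  subst (λ n → ∃[ A ] (IsHeffter n (4 * p + 3) A × IsGloballySimple n (4 * p + 3) A)) (sym n≡)
    (build (n / 4) (*-cancelˡ-< 4 p (n / 4) (subst (4 * p <_) n≡ (<-≤-trans (m<m+n (4 * p) (s≤s z≤n)) 4p+3≤n))))
  where
  n≡ : n ≡ 4 * (n / 4)
  n≡ = trans (m≡m%n+[m/n]*n n 4) (trans (cong (_+ n / 4 * 4) n%4≡0) (*-comm (n / 4) 4))
  build : ∀ m → p < m → ∃[ A ] (IsHeffter (4 * m) (4 * p + 3) A × IsGloballySimple (4 * m) (4 * p + 3) A)
  build (suc μ) (s≤s p≤μ) = Construction.array , Construction.isHeffter , Construction.isGloballySimple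
    where module Construction = Heffter.Construction μ p p≤μ
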